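{- Let $k\ge 1$ be an integer. If $\Gamma=(A,B,E)$ is a highly computable, computably bipartite graph satisfying the computable expanding Hall's harem condition with respect to $k$ (denoted $c.e.H.h.c.(k)$), then $\Gamma$ has a computable perfect $(1,k)$-matching.
   Context: Here $\mathbb{N}=\{0,1,2,\dots\}$. A bipartite graph $\Gamma=(A,B,E)$ has vertex set $V=A\sqcup B$ and edge set $E\subseteq A\times B$. Vertices $a\in A$, $b\in B$ are adjacent if $(a,b)\in E$. For a vertex $x$, $N_\Gamma(x)$ (also written $N(x)$) is the set of vertices adjacent to $x$; for $X\subseteq A$ or $X\subseteq B$, $N(X)=\bigcup_{x\in X}N(x)$. $\Gamma$ is locally finite if $N(x)$ is finite for every vertex $x$. $\Gamma$ is computable if there is a bijection $\nu:\mathbb{N}\to V$ such that $\{(i,j):(\nu(i),\nu(j))\in E\}$ is a computable set. It is computably bipartite if it is computable with respect to some $\nu$ and moreover $\nu^{ -1}(A)\subseteq\mathbb{N}$ is computable. A locally finite graph is highly computable if it is computable (with respect to $\nu$) and the function $n\mapsto |N_\Gamma(\nu(n))|$ is computable. The same fixed $\nu$ is used for all computability notions concerning $\Gamma$. A perfect $(1,k)$-matching for $\Gamma$ is a subset $M\subseteq E$ such that (1) for every $a\in A$ there are exactly $k$ vertices $b\in B$ with $(a,b)\in M$; (2) for every $b\in B$ there is a unique $a\in A$ with $(a,b)\in M$. It is computable if $\{(i,j):(\nu(i),\nu(j))\in M\}\subseteq\mathbb{N}\times\mathbb{N}$ is computable. $\Gamma$ satisfies $c.e.H.h.c.(k)$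 if there is a total computable function $h:\mathbb{N}\to\mathbb{N}$ such that: $h(0)=0$; for all finite $X\subseteq A$ and all $n\in\mathbb{N}$, $h(n)\le |X|$ implies $n\le |N(X)|-k|X|$; and for all finite $Y\subseteq B$ and all $n\in\mathbb{N}$, $h(n)\le |Y|$ implies $n\le |N(Y)|-\frac1k|Y|$. -}

module Defs where

open import Data.Fin using (Fin)
open import Data.Integer as ℤ using (ℤ; +_)
open import Data.List using (List; length)
open import Data.List.Membership.Propositional using (_∈_)
open import Data.List.Relation.Unary.Unique.Propositional using (Unique)
open import Data.Nat using (ℕ; zero; suc; _≤_; _<_; NonZero)
open import Data.Product using (∃; ∃-syntax; ∃!; _×_)
open import Data.Rational as ℚ using (ℚ; _/_)
open import Data.Sum using (_⊎_; inj₁; inj₂)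
open import Data.Empty using (⊥)
open import Data.Vec using (Vec; []; _∷_; lookup)
open import Data.Vec.Relation.Binary.Pointwise.Inductive using (Pointwise)
open import Function.Bundles using (_⤖_; _⇔_; module Bijection)
open import Level using (0ℓ)
open import Relation.Binary.Core using (REL; Rel; _⇒_)
open import Relation.Binary.PropositionalEquality using (_≡_)
open import Relation.Nullary using (¬_)
open import Relation.Unary using (Pred; _⊆_)

-- Computability is that of μ-recursive functions: `Rec n` is the syntax of
-- n-ary partial recursive functions and `e [ xs ]↦ y` says that e, applied
-- to xs, is defined with value y.

data Rec : ℕ → Set where
  zer  : ∀ {n} → Rec n
  succ : Rec 1
  proj : ∀ {n} → Fin n → Rec n
  comp : ∀ {m n} → Rec m → Vec (Rec n) m → Rec n
  prec : ∀ {n} → Rec n → Rec (suc (suc n)) → Rec (suc n)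
  mu   : ∀ {n} → Rec (suc n) → Rec n

infix 4 _[_]↦_

data _[_]↦_ : ∀ {n} → Rec n → Vec ℕ n → ℕ → Set where
  ↦zer    : ∀ {n} {xs : Vec ℕ n} → zer [ xs ]↦ 0
  ↦succ   : ∀ {x} → succ [ x ∷ [] ]↦ suc x
  ↦proj   : ∀ {n} {i : Fin n} {xs} → proj i [ xs ]↦ lookup xs i
  ↦comp   : ∀ {m n} {f : Rec m} {gs : Vec (Rec n) m} {xs ys z} →
            Pointwise (λ g y → g [ xs ]↦ y) gs ys →
            f [ ys ]↦ z → comp f gs [ xs ]↦ z
  ↦prec-z : ∀ {n} {f : Rec n} {g xs y} →
            f [ xs ]↦ y → prec f g [ zero ∷ xs ]↦ y
  ↦prec-s : ∀ {n} {f : Rec n} {g xs m r y} →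
            prec f g [ m ∷ xs ]↦ r → g [ m ∷ r ∷ xs ]↦ y →
            prec f g [ suc m ∷ xs ]↦ y
  ↦mu     : ∀ {n} {f : Rec (suc n)} {xs y} →
            (∀ z → z < y → ∃[ w ] f [ z ∷ xs ]↦ suc w) →
            f [ y ∷ xs ]↦ 0 → mu f [ xs ]↦ y

ComputableFun : (ℕ → ℕ) → Set
ComputableFun f = ∃[ e ] ∀ i → e [ i ∷ [] ]↦ f i

ComputableFun₂ : (ℕ → ℕ → ℕ) → Set
ComputableFun₂ f = ∃[ e ] ∀ i j → e [ i ∷ j ∷ [] ]↦ f i j

-- c is the value of the characteristic function at a point where membership
-- is the proposition P.
CharValue : Set → ℕ → Set
CharValue P c = (P × c ≡ 1) ⊎ (¬ P × c ≡ 0)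

ComputableSet : Pred ℕ 0ℓ → Set
ComputableSet S = ∃[ χ ] ComputableFun χ × (∀ i → CharValue (S i) (χ i))

ComputableRel : Rel ℕ 0ℓ → Set
ComputableRel R = ∃[ χ ] ComputableFun₂ χ × (∀ i j → CharValue (R i j) (χ i j))

-- P is a finite set with exactly n elements.
HasCard : {T : Set} → Pred T 0ℓ → ℕ → Set
HasCard {T} P n =
  ∃[ xs ] Unique {A = T} xs × (∀ x → x ∈ xs ⇔ P x) × length xs ≡ n

record BipartiteGraph : Set₁ where
  field
    A B : Set
    E   : REL A B 0ℓ

  V : Set
  V = A ⊎ B

  InA InB : Pred V 0ℓ
  InA v = ∃[ a ] v ≡ inj₁ a
  InB v = ∃[ b ] v ≡ inj₂ b

  -- A subset of A × B viewed as a subset of V × V.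
  onV : REL A B 0ℓ → Rel V 0ℓ
  onV R (inj₁ a) (inj₂ b) = R a b
  onV R (inj₁ _) (inj₁ _) = ⊥
  onV R (inj₂ _) _        = ⊥

  Adjacent : Rel V 0ℓ
  Adjacent x y = onV E x y ⊎ onV E y x

  N : V → Pred V 0ℓ
  N x = Adjacent x

  N[_] : Pred V 0ℓ → Pred V 0ℓ
  N[ X ] y = ∃[ x ] X x × N x y

  LocallyFinite : Set
  LocallyFinite = ∀ x → ∃[ n ] HasCard (N x) n

  module _ (ν : ℕ ⤖ V) where
    open Bijection ν using (to)

    ComputableOn : REL A B 0ℓ → Set
    ComputableOn R = ComputableRel (λ i j → onV R (to i) (to j))

    Computable : Set
    Computable = ComputableOn E

    ComputablyBipartite : Set
    ComputablyBipartite = Computable × ComputableSet (λ i → InA (to i))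

    HighlyComputable : Set
    HighlyComputable =
      LocallyFinite × Computable ×
      ∃[ d ] ComputableFun d × (∀ n → HasCard (N (to n)) (d n))

  record PerfectMatching (k : ℕ) (M : REL A B 0ℓ) : Set where
    field
      M⊆E     : M ⇒ E
      exactly : ∀ a → HasCard (M a) k
      unique  : ∀ b → ∃! _≡_ (λ a → M a b)

  -- The computable expanding Hall's harem condition.  In a locally finite
  -- graph N[ X ] is finite for finite X, so q below always exists.
  record CEHHC (k : ℕ) .{{_ : NonZero k}} : Set₁ where
    field
      h            : ℕ → ℕ
      h-computable : ComputableFun h
      h0           : h 0 ≡ 0
      expandA      : ∀ (X : Pred V 0ℓ) → X ⊆ InA →
                     ∀ p q → HasCard X p → HasCard N[ X ] q →
                     ∀ n → h n ≤ p → + n ℤ.≤ + q ℤ.- + k ℤ.* + p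
      expandB      : ∀ (Y : Pred V 0ℓ) → Y ⊆ InB →
                     ∀ p q → HasCard Y p → HasCard N[ Y ] q →
                     ∀ n → h n ≤ p →
                     + n / 1 ℚ.≤ + q / 1 ℚ.- (+ 1 / k) ℚ.* (+ p / 1)

{-# OPTIONS --safe #-}
-- The pairs (i , j) are examined one after the other.  An edge is put into the
-- matching if afterwards Hall's inequality w(X) ≤ w(N X) still holds for all
-- finite X on both sides, where w is the number of matching edges a vertex
-- still needs and N refers to the edges not yet examined.  If the inequality
-- fails, some set is tight for the edge, and then submodularity of X ↦ w(N X)
-- shows that the edge can be discarded instead.  Once all edges at i are
-- examined, Hall's inequality for {i} says that i needs no more edges.
--
-- Expansion makes the test effective: a set of large weight satisfies the
-- inequality anyway, and a set of small weight leaves a gap between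
-- consecutive layers around the examined edges, so that it splits into a part
-- in an explicitly bounded region and a part untouched by earlier decisions.
module Submission where

open import Defs
open import Data.Bool using (Bool; true; false; _∧_; _∨_; not; T)
open import Data.Bool.Properties using (∧-zeroʳ; ∧-identityʳ)
open import Data.Empty using (⊥; ⊥-elim)
open import Data.Fin as Fin using (Fin)
open import Data.Fin.Patterns
open import Data.Integer as ℤ using () renaming (+_ to pos)
import Data.Integer.Properties as ℤ
open import Data.Integer.Tactic.RingSolver using () renaming (solve-∀ to solveℤ-∀)
open import Data.List using (List; []; _∷_; length; map; filter; downFrom; _++_)
open import Data.List.Membership.Propositional using (_∈_)
open import Data.List.Membership.Propositional.Properties
  using (∈-∃++; ∈-filter⁺; ∈-filter⁻; ∈-downFrom⁺; ∈-downFrom⁻; ∈-map⁺; ∈-map⁻; ∈-++⁺ˡ; ∈-++⁺ʳ; ∈-++⁻)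
open import Data.List.Properties using (length-map; length-++)
open import Data.List.Relation.Unary.All as All using (All)
open import Data.List.Relation.Unary.AllPairs using ([]; _∷_)
open import Data.List.Relation.Unary.Any using (here; there)
open import Data.List.Relation.Unary.Unique.Propositional using (Unique)
import Data.List.Relation.Unary.Unique.Propositional.Properties as Unique
open import Data.Nat hiding (parity; _/_)
open import Data.Nat.Properties
open import Data.Nat.Tactic.RingSolver using (solve-∀)
open import Data.Product using (∃-syntax; ∃!; _×_; _,_; _,′_; proj₁; proj₂; swap)
open import Data.Rational as ℚ using (_/_)
import Data.Rational.Properties as ℚ
open import Data.Rational.Unnormalised as ℚᵘ using (mkℚᵘ)
import Data.Rational.Unnormalised.Properties as ℚᵘ
open import Data.Sum using (_⊎_; inj₁; inj₂; map₂)
open import Data.Sum.Properties using (inj₁-injective)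
open import Data.Vec as Vec using (Vec; []; _∷_; lookup)
open import Data.Vec.Relation.Binary.Pointwise.Inductive using (Pointwise; []; _∷_)
open import Function using (_∘_; flip; case_of_)
open import Function.Bundles using (_⤖_; mk⇔; module Bijection; module Equivalence)
open import Level using (0ℓ)
open import Relation.Binary.Core using (REL; _⇒_)
open import Relation.Binary.Definitions using (tri<; tri≈; tri>)
open import Relation.Binary.PropositionalEquality
open import Relation.Nullary
open import Relation.Nullary.Decidable using (decidable-stable)
open import Relation.Unary using (Pred)

-- Expansion is never carried along as an invariant. It is used only for the original data `R`,
-- `wA`, `wB`, while the run maintains plain Hall inequalities, which quantify over all finite sets
-- and are not decidable as they stand. What links the two is that an edge number bounds both ends
-- of its edge: after `n` decisions, edges and weights have changed only at vertices below `n`. A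
-- set therefore loses at most `∑ n wB` of neighbouring weight, and `h (∑ n wB)` is the weight from
-- which expansion pays for that loss. This is the origin of `size`. Weight `k` on the left and 1 on
-- the right replaces splitting a vertex of A into `k` copies, and makes the two Hall conditions one
-- statement about a graph and its `flip`. No tight set is ever searched for. That a failed test
-- permits discarding the edge is proved under a double negation, which goes away because every
-- single Hall inequality is a comparison of natural numbers.

-- Bounded quantifiers and finite sums.

𝟙 : Bool → ℕ
𝟙 true  = 1
𝟙 false = 0

-- The recursion scheme of `prec`. `∑`, `layer` and `state` are defined through it so that `natrecᶜ`
-- yields their codes directly.
natrec : ℕ → (ℕ → ℕ → ℕ) → ℕ → ℕ
natrec z s zero    = z
natrec z s (suc m) = s m (natrec z s m)

∑ : ℕ → (ℕ → ℕ) → ℕ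
∑ m f = natrec 0 (λ i r → r + f i) m

all< : ℕ → (ℕ → Bool) → Bool
all< zero    φ = true
all< (suc m) φ = all< m φ ∧ φ m

any< : ℕ → (ℕ → Bool) → Bool
any< m φ = not (all< m (λ i → not (φ i)))

∧-elim : ∀ {x y} → x ∧ y ≡ true → x ≡ true × y ≡ true
∧-elim {true} {true} _ = refl , refl

not-true : ∀ {x} → not x ≡ true → x ≡ false
not-true {false} _ = refl

≢true : ∀ {x} → x ≢ true → x ≡ false
≢true {true}  p = ⊥-elim (p refl)
≢true {false} p = refl

true? : ∀ x → Dec (x ≡ true)
true? true  = yes refl
true? false = no λ ()

≤ᵇ-true : ∀ {m n} → m ≤ n → (m ≤ᵇ n) ≡ true
≤ᵇ-true {m} {n} p with m ≤ᵇ n | ≤⇒≤ᵇ p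
... | true | _ = refl

≤ᵇ-≤ : ∀ {m n} → (m ≤ᵇ n) ≡ true → m ≤ n
≤ᵇ-≤ {m} {n} p = ≤ᵇ⇒≤ m n (subst (λ b → Data.Bool.T b) (sym p) _)

all<-elim : ∀ m {φ} → all< m φ ≡ true → ∀ i → i < m → φ i ≡ true
all<-elim (suc m) p i i< with ∧-elim p | m<1+n⇒m<n∨m≡n i<
... | q , _ | inj₁ i<m  = all<-elim m q i i<m
... | _ , q | inj₂ refl = q

all<-intro : ∀ m {φ} → (∀ i → i < m → φ i ≡ true) → all< m φ ≡ true
all<-intro zero    p = refl
all<-intro (suc m) p = cong₂ _∧_ (all<-intro m λ i i< → p i (m<n⇒m<1+n i<)) (p m ≤-refl)

any<-intro : ∀ m {φ} i → i < m → φ i ≡ true → any< m φ ≡ true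
any<-intro m {φ} i i<m p with all< m (λ i → not (φ i)) in eq
... | false = refl
... | true with all<-elim m eq i i<m
...   | q rewrite p = q

any<-elim : ∀ m {φ} → any< m φ ≡ true → ∃[ i ] φ i ≡ true
any<-elim (suc m) {φ} p with φ m in eq
... | true = m , eq
... | false with all< m (λ i → not (φ i)) in eq′
...   | false = any<-elim m (cong not eq′)

∑-mono : ∀ m {f g} → (∀ i → i < m → f i ≤ g i) → ∑ m f ≤ ∑ m g
∑-mono zero    p = z≤n
∑-mono (suc m) p = +-mono-≤ (∑-mono m λ i i< → p i (m<n⇒m<1+n i<)) (p m ≤-refl)

∑-cong : ∀ m {f g} → (∀ i → i < m → f i ≡ g i) → ∑ m f ≡ ∑ m g
∑-cong zero    p = refl
∑-cong (suc m) p = cong₂ _+_ (∑-cong m λ i i< → p i (m<n⇒m<1+n i<)) (p m ≤-refl)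

∑-+ : ∀ m f g → ∑ m (λ i → f i + g i) ≡ ∑ m f + ∑ m g
∑-+ zero    f g = refl
∑-+ (suc m) f g rewrite ∑-+ m f g = lemma (∑ m f) (∑ m g) (f m) (g m)
  where
  lemma : ∀ a b c d → a + b + (c + d) ≡ a + c + (b + d)
  lemma = solve-∀

∑-*ʳ : ∀ m f k → ∑ m (λ i → f i * k) ≡ ∑ m f * k
∑-*ʳ zero    f k = refl
∑-*ʳ (suc m) f k = trans (cong (_+ f m * k) (∑-*ʳ m f k)) (sym (*-distribʳ-+ k (∑ m f) (f m)))

∑-≤ : ∀ {m n} f → m ≤ n → ∑ m f ≤ ∑ n f
∑-≤ {n = zero}  f z≤n = z≤n
∑-≤ {n = suc n} f m≤n with m≤n⇒m<n∨m≡n m≤n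
... | inj₁ (s≤s m≤) = ≤-trans (∑-≤ f m≤) (m≤m+n _ _)
... | inj₂ refl     = ≤-refl

∑-extend : ∀ {m n f} → m ≤ n → (∀ i → m ≤ i → f i ≡ 0) → ∑ n f ≡ ∑ m f
∑-extend {n = zero}  z≤n z = refl
∑-extend {n = suc n} {f} m≤n z with m≤n⇒m<n∨m≡n m≤n
... | inj₁ (s≤s m≤) = trans (cong₂ _+_ (∑-extend m≤ z) (z n m≤)) (+-identityʳ _)
... | inj₂ refl     = refl

term≤∑ : ∀ {m i} f → i < m → f i ≤ ∑ m f
term≤∑ {suc m} f i<m with m<1+n⇒m<n∨m≡n i<m
... | inj₁ i<  = ≤-trans (term≤∑ f i<) (m≤m+n _ _)
... | inj₂ refl = m≤n+m _ _

∑-zero : ∀ m {f} → (∀ i → i < m → f i ≡ 0) → ∑ m f ≡ 0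
∑-zero zero    z = refl
∑-zero (suc m) z = cong₂ _+_ (∑-zero m λ i i< → z i (m<n⇒m<1+n i<)) (z m ≤-refl)

δ : ℕ → ℕ → ℕ
δ u j = 𝟙 (u ≡ᵇ j)

δ-diag : ∀ u → δ u u ≡ 1
δ-diag zero    = refl
δ-diag (suc u) = δ-diag u

δ-off : ∀ {u j} → j ≢ u → δ u j ≡ 0
δ-off {zero}  {zero}  p = ⊥-elim (p refl)
δ-off {zero}  {suc j} p = refl
δ-off {suc u} {zero}  p = refl
δ-off {suc u} {suc j} p = δ-off (p ∘ cong suc)

∑δ≤1 : ∀ m u → ∑ m (δ u) ≤ 1
∑δ≤1 zero    u = z≤n
∑δ≤1 (suc m) u with m ≟ u
... | yes refl rewrite ∑-zero m {δ m} (λ i i< → δ-off (<⇒≢ i<)) = ≤-reflexive (δ-diag m)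
... | no  m≢u  rewrite δ-off {u} {m} m≢u | +-identityʳ (∑ m (δ u)) = ∑δ≤1 m u

-- Adding `δ v` to `f` moves the extra unit to the index `v`, where there is room for it, and leaves
-- a pointwise comparison.
∑-suc-≤ : ∀ {m v f g} → v < m → (∀ i → i ≢ v → f i ≤ g i) → suc (f v) ≤ g v →
          suc (∑ m f) ≤ ∑ m g
∑-suc-≤ {m} {v} {f} {g} v<m off on = begin
  suc (∑ m f)                ≡⟨ +-comm 1 _ ⟩
  ∑ m f + 1                  ≡⟨ cong (∑ m f +_) (δ-diag v) ⟨
  ∑ m f + δ v v              ≤⟨ +-monoʳ-≤ (∑ m f) (term≤∑ (δ v) v<m) ⟩
  ∑ m f + ∑ m (δ v)          ≡⟨ ∑-+ m f (δ v) ⟨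
  ∑ m (λ i → f i + δ v i)    ≤⟨ ∑-mono m (λ i _ → pointwise i) ⟩
  ∑ m g                      ∎
  where
  open ≤-Reasoning
  pointwise : ∀ i → f i + δ v i ≤ g i
  pointwise i with i ≟ v
  ... | yes refl rewrite δ-diag i | +-comm (f i) 1 = on
  ... | no  i≢v  rewrite δ-off i≢v | +-identityʳ (f i) = off i i≢v

∑-≤-suc : ∀ m {v f g} → (∀ i → i ≢ v → f i ≤ g i) → f v ≤ suc (g v) →
          ∑ m f ≤ suc (∑ m g)
∑-≤-suc m {v} {f} {g} off on = begin
  ∑ m f                      ≤⟨ ∑-mono m (λ i _ → pointwise i) ⟩
  ∑ m (λ i → δ v i + g i)    ≡⟨ ∑-+ m (δ v) g ⟩
  ∑ m (δ v) + ∑ m g          ≤⟨ +-monoˡ-≤ (∑ m g) (∑δ≤1 m v) ⟩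
  suc (∑ m g)                ∎
  where
  open ≤-Reasoning
  pointwise : ∀ i → f i ≤ δ v i + g i
  pointwise i with i ≟ v
  ... | yes refl rewrite δ-diag i = on
  ... | no  i≢v  rewrite δ-off i≢v = off i i≢v

≤ᵇ-false : ∀ {m n} → n < m → (m ≤ᵇ n) ≡ false
≤ᵇ-false n<m = ≢true λ p → <⇒≱ n<m (≤ᵇ-≤ p)

∑-gap : ∀ {m n f} → m ≤ n → ∑ n f ≤ ∑ m f → ∀ i → m ≤ i → i < n → f i ≡ 0
∑-gap {m} {suc n} {f} m≤n le i m≤i i<n with m≤n⇒m<n∨m≡n m≤n
... | inj₂ refl = ⊥-elim (<⇒≱ i<n m≤i)
... | inj₁ (s≤s m≤n′) with m<1+n⇒m<n∨m≡n i<n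
...   | inj₁ i<n′ = ∑-gap m≤n′ (≤-trans (m≤m+n _ (f n)) le) i m≤i i<n′
...   | inj₂ refl = n≤0⇒n≡0 (+-cancelˡ-≤ (∑ n f) _ _ (begin
          ∑ n f + f n   ≤⟨ le ⟩
          ∑ m f         ≤⟨ ∑-≤ f m≤n′ ⟩
          ∑ n f         ≡⟨ +-identityʳ _ ⟨
          ∑ n f + 0     ∎))
  where open ≤-Reasoning

-- Binary digits as codes of finite sets, and a pairing function.

parity half : ℕ → ℕ
parity = natrec 0 (λ _ r → 1 ∸ r)
half   = natrec 0 (λ m r → r + parity m)

shift : ℕ → ℕ → ℕ
shift i c = natrec c (λ _ → half) i

bit : ℕ → ℕ → Bool
bit i c = 1 ≤ᵇ parity (shift i c)

push : ℕ → Bool → ℕ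
push c x = c + c + 𝟙 x

parity-double : ∀ c → parity (c + c) ≡ 0
parity-double zero    = refl
parity-double (suc c) rewrite +-suc c c | parity-double c = refl

half-double : ∀ c → half (c + c) ≡ c
half-double zero    = refl
half-double (suc c) rewrite +-suc c c | parity-double c | half-double c = trans (cong (_+ 1) (+-identityʳ c)) (+-comm c 1)

bit-zero-push : ∀ c x → bit 0 (push c x) ≡ x
bit-zero-push c false rewrite +-identityʳ (c + c) | parity-double c = refl
bit-zero-push c true  rewrite +-comm (c + c) 1 | parity-double c = refl

half-push : ∀ c x → half (push c x) ≡ c
half-push c false rewrite +-identityʳ (c + c) = half-double c
half-push c true  rewrite +-comm (c + c) 1 | parity-double c | half-double c = +-identityʳ c

shift-half : ∀ i c → shift (suc i) c ≡ shift i (half c)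
shift-half zero    c = refl
shift-half (suc i) c = cong half (shift-half i c)

bit-suc-push : ∀ i c x → bit (suc i) (push c x) ≡ bit i c
bit-suc-push i c x rewrite shift-half i (push c x) | half-push c x = refl

push-< : ∀ {L c} x → c < 2 ^ L → push c x < 2 ^ suc L
push-< {L} {c} x c< = begin
  suc (c + c + 𝟙 x)      ≤⟨ s≤s (+-monoʳ-≤ (c + c) (𝟙≤1 x)) ⟩
  suc (c + c + 1)        ≡⟨ lemma c ⟩
  suc c + (suc c + 0)    ≤⟨ *-monoʳ-≤ 2 c< ⟩
  2 ^ suc L              ∎
  where
  open ≤-Reasoning
  lemma : ∀ c → suc (c + c + 1) ≡ suc c + (suc c + 0)
  lemma = solve-∀
  𝟙≤1 : ∀ x → 𝟙 x ≤ 1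
  𝟙≤1 true  = ≤-refl
  𝟙≤1 false = z≤n

bits-surjective : ∀ L (X : ℕ → Bool) → ∃[ c ] c < 2 ^ L × (∀ i → i < L → bit i c ≡ X i)
bits-surjective zero    X = 0 , s≤s z≤n , λ _ ()
bits-surjective (suc L) X with bits-surjective L (X ∘ suc)
... | c , c< , bits = push c (X 0) , push-< {L} (X 0) c< , λ where
  zero    _         → bit-zero-push c (X 0)
  (suc i) (s≤s i<L) → trans (bit-suc-push i c (X 0)) (bits i i<L)

-- With `s = i + j` this is `s * s + s + i`. Since `i ≤ s` and consecutive values of `s * s + s`
-- differ by `2 * s + 2`, the blocks for different `s` are disjoint, which gives injectivity. Both
-- arguments are at most the code, so the edges numbered below `n` touch only vertices below `n`.
pair : ℕ → ℕ → ℕ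
pair i j = (i + j) * (i + j) + (i + j) + i

pair-≥ˡ : ∀ i j → i ≤ pair i j
pair-≥ˡ i j = m≤n+m i _

pair-≥ʳ : ∀ i j → j ≤ pair i j
pair-≥ʳ i j = ≤-trans (m≤n+m j i) (≤-trans (m≤n+m (i + j) ((i + j) * (i + j))) (m≤m+n _ i))

pair-sum-mono : ∀ {i j i′ j′} → i + j < i′ + j′ → pair i j < pair i′ j′
pair-sum-mono {i} {j} {i′} {j′} s<s′ = begin-strict
  s * s + s + i              ≤⟨ +-monoʳ-≤ (s * s + s) (m≤m+n i j) ⟩
  s * s + s + s              <⟨ m<m+n _ {2} (s≤s z≤n) ⟩
  s * s + s + s + 2          ≤⟨ m≤m+n _ s ⟩
  s * s + s + s + 2 + s      ≡⟨ lemma s ⟩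
  suc s * suc s + suc s      ≤⟨ +-mono-≤ (*-mono-≤ s<s′ s<s′) s<s′ ⟩
  s′ * s′ + s′               ≤⟨ m≤m+n _ i′ ⟩
  s′ * s′ + s′ + i′          ∎
  where
  open ≤-Reasoning
  s = i + j
  s′ = i′ + j′
  lemma : ∀ s → s * s + s + s + 2 + s ≡ suc s * suc s + suc s
  lemma = solve-∀

pair-injective : ∀ {i j i′ j′} → pair i j ≡ pair i′ j′ → i ≡ i′ × j ≡ j′
pair-injective {i} {j} {i′} {j′} eq with <-cmp (i + j) (i′ + j′)
... | tri< lt _ _ = ⊥-elim (<⇒≢ (pair-sum-mono {i} {j} {i′} {j′} lt) eq)
... | tri> _ _ gt = ⊥-elim (<⇒≢ (pair-sum-mono {i′} {j′} {i} {j} gt) (sym eq))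
... | tri≈ _ s≡ _ rewrite s≡ with refl ← +-cancelˡ-≡ ((i′ + j′) * (i′ + j′) + (i′ + j′)) i i′ eq =
  refl , +-cancelˡ-≡ i j j′ s≡

-- Computable functions

record Comp (n : ℕ) (f : Vec ℕ n → ℕ) : Set where
  constructor comp-by
  field
    code    : Rec n
    correct : ∀ xs → code [ xs ]↦ f xs

open Comp

-- Unification cannot recover `φ` from `𝟙 (φ xs)`; the wrapper keeps `φ` visible as an index.
record Compᵇ (n : ℕ) (φ : Vec ℕ n → Bool) : Set where
  constructor via-𝟙
  field
    value : Comp n (λ xs → 𝟙 (φ xs))

open Compᵇ

Comp₁ : (ℕ → ℕ) → Set
Comp₁ f = Comp 1 (λ xs → f (lookup xs 0F))

Comp₂ : (ℕ → ℕ → ℕ) → Set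
Comp₂ f = Comp 2 (λ xs → f (lookup xs 0F) (lookup xs 1F))

Comp₃ : (ℕ → ℕ → ℕ → ℕ) → Set
Comp₃ f = Comp 3 (λ xs → f (lookup xs 0F) (lookup xs 1F) (lookup xs 2F))

Comp₂ᵇ : (ℕ → ℕ → Bool) → Set
Comp₂ᵇ φ = Compᵇ 2 (λ xs → φ (lookup xs 0F) (lookup xs 1F))

Comp₃ᵇ : (ℕ → ℕ → ℕ → Bool) → Set
Comp₃ᵇ φ = Compᵇ 3 (λ xs → φ (lookup xs 0F) (lookup xs 1F) (lookup xs 2F))

Comp₄ᵇ : (ℕ → ℕ → ℕ → ℕ → Bool) → Set
Comp₄ᵇ φ = Compᵇ 4 (λ xs → φ (lookup xs 0F) (lookup xs 1F) (lookup xs 2F) (lookup xs 3F))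

from-fun : ∀ {f} → ComputableFun f → Comp₁ f
from-fun (e , p) = comp-by e λ { (i ∷ []) → p i }

from-fun₂ : ∀ {f} → ComputableFun₂ f → Comp₂ f
from-fun₂ (e , p) = comp-by e λ { (i ∷ j ∷ []) → p i j }

to-fun₂ : ∀ {f} → Comp₂ f → ComputableFun₂ f
to-fun₂ c = code c , λ i j → correct c (i ∷ j ∷ [])

infixr 5 _∷ₐ_
-- Indexed by the vector function itself, so that `lookup` into the arguments of a `call` reduces
-- and the resulting type is the intended one by computation.
data Args (n : ℕ) : (m : ℕ) → (Vec ℕ n → Vec ℕ m) → Set where
  []ₐ  : Args n 0 (λ _ → [])
  _∷ₐ_ : ∀ {m f fs} → Comp n f → Args n m fs → Args n (suc m) (λ xs → f xs ∷ fs xs)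

codes : ∀ {n m fs} → Args n m fs → Vec (Rec n) m
codes []ₐ       = []
codes (c ∷ₐ cs) = code c ∷ codes cs

codes-correct : ∀ {n m fs} (cs : Args n m fs) xs → Pointwise (λ g y → g [ xs ]↦ y) (codes cs) (fs xs)
codes-correct []ₐ       xs = []
codes-correct (c ∷ₐ cs) xs = correct c xs ∷ codes-correct cs xs

call : ∀ {m n f fs} → Comp m f → Args n m fs → Comp n (λ xs → f (fs xs))
call c cs = comp-by (comp (code c) (codes cs)) λ xs → ↦comp (codes-correct cs xs) (correct c _)

callᵇ : ∀ {m n φ fs} → Compᵇ m φ → Args n m fs → Compᵇ n (λ xs → φ (fs xs))
callᵇ c cs = via-𝟙 (call (value c) cs)

ext : ∀ {n f g} → (∀ xs → f xs ≡ g xs) → Comp n f → Comp n g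
ext eq c = comp-by (code c) λ xs → subst (code c [ xs ]↦_) (eq xs) (correct c xs)

var : ∀ {n} (i : Fin n) → Comp n (λ xs → lookup xs i)
var i = comp-by (proj i) λ xs → ↦proj

sucᶜ : ∀ {n f} → Comp n f → Comp n (λ xs → suc (f xs))
sucᶜ {f = f} c = comp-by (comp succ (code c ∷ [])) λ xs → ↦comp (correct c xs ∷ []) ↦succ

lit : ∀ {n} k → Comp n (λ _ → k)
lit zero    = comp-by zer λ xs → ↦zer
lit (suc k) = sucᶜ (lit k)

projections : ∀ {n m} (ρ : Fin m → Fin n) (xs : Vec ℕ n) (ys : Vec ℕ m) →
              (∀ i → lookup xs (ρ i) ≡ lookup ys i) →
              Pointwise (λ g y → g [ xs ]↦ y) (Vec.tabulate (proj ∘ ρ)) ys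
projections ρ xs []       eq = []
projections ρ xs (y ∷ ys) eq =
  subst (proj (ρ Fin.zero) [ xs ]↦_) (eq Fin.zero) ↦proj ∷ projections (ρ ∘ Fin.suc) xs ys (eq ∘ Fin.suc)

natrecᶜ : ∀ {n z s t} → Comp n z → Comp (suc (suc n)) s → Comp n t →
          Comp n (λ xs → natrec (z xs) (λ m r → s (m ∷ r ∷ xs)) (t xs))
natrecᶜ {n} {z} {s} cz cs ct = comp-by
  (comp (prec (code cz) (code cs)) (code ct ∷ Vec.tabulate proj))
  λ xs → ↦comp (correct ct xs ∷ projections (λ i → i) xs xs (λ _ → refl)) (loop xs _)
  where
  loop : ∀ xs m → prec (code cz) (code cs) [ m ∷ xs ]↦ natrec (z xs) (λ m r → s (m ∷ r ∷ xs)) m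
  loop xs zero    = ↦prec-z (correct cz xs)
  loop xs (suc m) = ↦prec-s (loop xs m) (correct cs _)

-- `prec` hands the accumulator to its step function right after the index; the body of a sum or
-- quantifier has to skip it.
under-acc : ∀ {n f} → Comp (suc n) f → Comp (suc (suc n)) (λ { (m ∷ r ∷ xs) → f (m ∷ xs) })
under-acc c = comp-by (comp (code c) (proj Fin.zero ∷ Vec.tabulate (λ i → proj (Fin.suc (Fin.suc i)))))
  λ { (m ∷ r ∷ xs) → ↦comp (↦proj ∷ projections (λ i → Fin.suc (Fin.suc i)) (m ∷ r ∷ xs) xs (λ _ → refl)) (correct c _) }

minimise : ∀ {n g} (f : Vec ℕ n → ℕ) → Comp (suc n) g →
           (∀ xs → g (f xs ∷ xs) ≡ 0) → (∀ xs z → z < f xs → g (z ∷ xs) ≢ 0) → Comp n f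
minimise {n} {g} f c root least = comp-by (mu (code c)) λ xs →
  ↦mu (λ z z< → pred (g (z ∷ xs)) , subst (code c [ z ∷ xs ]↦_) (sym (suc-pred _ ⦃ ≢-nonZero (least xs z z<) ⦄)) (correct c _))
      (subst (code c [ f xs ∷ xs ]↦_) (root xs) (correct c _))

infixl 6 _+ᶜ_ _∸ᶜ_
infixl 7 _*ᶜ_
infix  4 _≤ᶜ_
infixr 6 _∧ᶜ_

_+ᶜ_ : ∀ {n f g} → Comp n f → Comp n g → Comp n (λ xs → f xs + g xs)
_+ᶜ_ {n} {f} {g} a b = ext (λ xs → lemma (g xs) (f xs)) (natrecᶜ b (sucᶜ (var 1F)) a)
  where
  lemma : ∀ y x → natrec y (λ _ r → suc r) x ≡ x + y
  lemma y zero    = refl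
  lemma y (suc x) = cong suc (lemma y x)

_*ᶜ_ : ∀ {n f g} → Comp n f → Comp n g → Comp n (λ xs → f xs * g xs)
_*ᶜ_ {n} {f} {g} a b = ext (λ xs → lemma (f xs) (g xs))
  (call {f = λ xs → natrec 0 (λ _ r → lookup xs 1F + r) (lookup xs 0F)}
    (natrecᶜ (lit 0) (var 3F +ᶜ var 1F) (var 0F)) (a ∷ₐ b ∷ₐ []ₐ))
  where
  lemma : ∀ x y → natrec 0 (λ _ r → y + r) x ≡ x * y
  lemma zero    y = refl
  lemma (suc x) y = cong (y +_) (lemma x y)

predᶜ : ∀ {n f} → Comp n f → Comp n (λ xs → pred (f xs))
predᶜ {f = f} a = ext (λ xs → lemma (f xs)) (natrecᶜ (lit 0) (var 0F) a)
  where
  lemma : ∀ x → natrec 0 (λ m _ → m) x ≡ pred x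
  lemma zero    = refl
  lemma (suc x) = refl

_∸ᶜ_ : ∀ {n f g} → Comp n f → Comp n g → Comp n (λ xs → f xs ∸ g xs)
_∸ᶜ_ {n} {f} {g} a b = ext (λ xs → lemma (f xs) (g xs)) (natrecᶜ a (predᶜ (var 1F)) b)
  where
  lemma : ∀ x y → natrec x (λ _ r → pred r) y ≡ x ∸ y
  lemma x zero    = refl
  lemma x (suc y) = trans (cong pred (lemma x y)) (pred[m∸n]≡m∸[1+n] x y)

_≤ᶜ_ : ∀ {n f g} → Comp n f → Comp n g → Compᵇ n (λ xs → f xs ≤ᵇ g xs)
_≤ᶜ_ {n} {f} {g} a b = via-𝟙 (ext (λ xs → lemma (f xs) (g xs)) (lit 1 ∸ᶜ (a ∸ᶜ b)))
  where
  lemma : ∀ x y → 1 ∸ (x ∸ y) ≡ 𝟙 (x ≤ᵇ y)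
  lemma x y with x ≤? y
  ... | yes p rewrite ≤ᵇ-true p | m≤n⇒m∸n≡0 p = refl
  ... | no ¬p rewrite ≤ᵇ-false (≰⇒> ¬p) | m≤n⇒m∸n≡0 (m<n⇒0<n∸m (≰⇒> ¬p)) = refl

_∧ᶜ_ : ∀ {n φ ψ} → Compᵇ n φ → Compᵇ n ψ → Compᵇ n (λ xs → φ xs ∧ ψ xs)
_∧ᶜ_ {n} {φ} {ψ} a b = via-𝟙 (ext (λ xs → lemma (φ xs) (ψ xs)) (value a *ᶜ value b))
  where
  lemma : ∀ x y → 𝟙 x * 𝟙 y ≡ 𝟙 (x ∧ y)
  lemma true  true  = refl
  lemma true  false = refl
  lemma false _     = refl

notᶜ : ∀ {n φ} → Compᵇ n φ → Compᵇ n (λ xs → not (φ xs))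
notᶜ {n} {φ} a = via-𝟙 (ext (λ xs → lemma (φ xs)) (lit 1 ∸ᶜ value a))
  where
  lemma : ∀ x → 1 ∸ 𝟙 x ≡ 𝟙 (not x)
  lemma true  = refl
  lemma false = refl

∑ᶜ : ∀ {n b f} → Comp n b → Comp (suc n) f → Comp n (λ xs → ∑ (b xs) (λ i → f (i ∷ xs)))
∑ᶜ b c = natrecᶜ (lit 0) (var 1F +ᶜ under-acc c) b

all<ᶜ : ∀ {n b φ} → Comp n b → Compᵇ (suc n) φ → Compᵇ n (λ xs → all< (b xs) (λ i → φ (i ∷ xs)))
all<ᶜ {n} {b} {φ} cb c =
  via-𝟙 (ext (λ xs → lemma xs (b xs)) (natrecᶜ (lit 1) (var 1F *ᶜ under-acc (value c)) cb))
  where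
  lemma : ∀ xs m → natrec 1 (λ i r → r * 𝟙 (φ (i ∷ xs))) m ≡ 𝟙 (all< m (λ i → φ (i ∷ xs)))
  lemma xs zero    = refl
  lemma xs (suc m) rewrite lemma xs m with all< m (λ i → φ (i ∷ xs)) | φ (m ∷ xs)
  ... | true  | true  = refl
  ... | true  | false = refl
  ... | false | _     = refl

any<ᶜ : ∀ {n b φ} → Comp n b → Compᵇ (suc n) φ → Compᵇ n (λ xs → any< (b xs) (λ i → φ (i ∷ xs)))
any<ᶜ b c = notᶜ (all<ᶜ b (notᶜ c))

2^ᶜ : ∀ {n f} → Comp n f → Comp n (λ xs → 2 ^ f xs)
2^ᶜ {f = f} c = ext (λ xs → lemma (f xs)) (natrecᶜ (lit 1) (lit 2 *ᶜ var 1F) c)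
  where
  lemma : ∀ x → natrec 1 (λ _ r → 2 * r) x ≡ 2 ^ x
  lemma zero    = refl
  lemma (suc x) = cong (2 *_) (lemma x)

parityᶜ : Comp₁ parity
parityᶜ = natrecᶜ (lit 0) (lit 1 ∸ᶜ var 1F) (var 0F)

halfᶜ : Comp₁ half
halfᶜ = natrecᶜ (lit 0) (var 1F +ᶜ call parityᶜ (var 0F ∷ₐ []ₐ)) (var 0F)

bitᶜ : Comp₂ᵇ bit
bitᶜ = lit 1 ≤ᶜ call parityᶜ (natrecᶜ (var 1F) (call halfᶜ (var 1F ∷ₐ []ₐ)) (var 0F) ∷ₐ []ₐ)

pairᶜ : Comp₂ pair
pairᶜ = (var 0F +ᶜ var 1F) *ᶜ (var 0F +ᶜ var 1F) +ᶜ (var 0F +ᶜ var 1F) +ᶜ var 0F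

-- Sets of natural numbers and bipartite graphs on ℕ ⊔ ℕ

Graph : Set
Graph = ℕ → ℕ → Bool

infix 4 _∋_ _⊆_ _⊂<_ _⊑_

_∋_ : (ℕ → Bool) → ℕ → Set
X ∋ i = X i ≡ true

_⊆_ : (ℕ → Bool) → (ℕ → Bool) → Set
X ⊆ Y = ∀ i → X ∋ i → Y ∋ i

_⊂<_ : (ℕ → Bool) → ℕ → Set
X ⊂< m = ∀ i → X ∋ i → i < m

_⊑_ : Graph → Graph → Set
R ⊑ S = ∀ i j → R i j ≡ true → S i j ≡ true

_∪_ _∩_ _∖_ : (ℕ → Bool) → (ℕ → Bool) → ℕ → Bool
(X ∪ Y) i = X i ∨ Y i
(X ∩ Y) i = X i ∧ Y i
(X ∖ Y) i = X i ∧ not (Y i)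

W : ℕ → (ℕ → ℕ) → (ℕ → Bool) → ℕ
W m w X = ∑ m (λ i → 𝟙 (X i) * w i)

∪-elim : ∀ X Y {i} → X ∪ Y ∋ i → X ∋ i ⊎ Y ∋ i
∪-elim X Y {i} p with X i
... | true  = inj₁ refl
... | false = inj₂ p

∪-introˡ : ∀ X Y {i} → X ∋ i → X ∪ Y ∋ i
∪-introˡ X Y p rewrite p = refl

∪-introʳ : ∀ X Y {i} → Y ∋ i → X ∪ Y ∋ i
∪-introʳ X Y {i} p with X i
... | true  = refl
... | false = p

∩-intro : ∀ X Y {i} → X ∋ i → Y ∋ i → X ∩ Y ∋ i
∩-intro X Y p q rewrite p = q

∖-intro : ∀ X Y {i} → X ∋ i → Y i ≡ false → X ∖ Y ∋ i
∖-intro X Y p q rewrite p | q = refl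

∖-elim : ∀ X Y {i} → X ∖ Y ∋ i → X ∋ i × Y i ≡ false
∖-elim X Y p with ∧-elim p
... | x , y = x , not-true y

∌-false : ∀ {x} → x ≡ true → x ≡ false → ⊥
∌-false refl ()

𝟙≤ : ∀ x y n → (x ≡ true → y ≡ true) → 𝟙 x * n ≤ 𝟙 y * n
𝟙≤ false y n p = z≤n
𝟙≤ true  y n p rewrite p refl = ≤-refl

W-⊆ : ∀ m w {X Y} → X ⊆ Y → W m w X ≤ W m w Y
W-⊆ m w {X} {Y} s = ∑-mono m (λ i _ → 𝟙≤ (X i) (Y i) (w i) (s i))

W-weight : ∀ m {a b} X → (∀ i → a i ≤ b i) → W m a X ≤ W m b X
W-weight m X le = ∑-mono m (λ i _ → *-monoʳ-≤ (𝟙 (X i)) (le i))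

W-extend : ∀ {m n} w {X} → X ⊂< m → m ≤ n → W n w X ≡ W m w X
W-extend {m} w {X} X< m≤n = ∑-extend m≤n z
  where
  z : ∀ i → m ≤ i → 𝟙 (X i) * w i ≡ 0
  z i m≤i with X i in eq
  ... | false = refl
  ... | true  = ⊥-elim (<⇒≱ (X< i eq) m≤i)

W-∪∩ : ∀ m w X Y → W m w X + W m w Y ≡ W m w (X ∪ Y) + W m w (X ∩ Y)
W-∪∩ m w X Y = trans (sym (∑-+ m _ _)) (trans (∑-cong m (λ i _ → pointwise i)) (∑-+ m _ _))
  where
  pointwise : ∀ i → 𝟙 (X i) * w i + 𝟙 (Y i) * w i ≡ 𝟙 (X i ∨ Y i) * w i + 𝟙 (X i ∧ Y i) * w i
  pointwise i with X i | Y i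
  ... | true  | true  = refl
  ... | true  | false = refl
  ... | false | true  = sym (+-identityʳ _)
  ... | false | false = refl

W-∩∖ : ∀ m w X Y → W m w X ≡ W m w (X ∩ Y) + W m w (X ∖ Y)
W-∩∖ m w X Y = trans (∑-cong m (λ i _ → pointwise i)) (∑-+ m _ _)
  where
  pointwise : ∀ i → 𝟙 (X i) * w i ≡ 𝟙 (X i ∧ Y i) * w i + 𝟙 (X i ∧ not (Y i)) * w i
  pointwise i with X i | Y i
  ... | true  | true  = sym (+-identityʳ _)
  ... | true  | false = refl
  ... | false | _     = refl

infixl 6 _-_
_-_ : (ℕ → Bool) → ℕ → ℕ → Bool
X - v = X ∖ (v ≡ᵇ_)

∉- : ∀ X v → (X - v) v ≡ false
∉- X v = ≢true λ p → ∌-false (≡ᵇ-refl v) (not-true (proj₂ (∧-elim p)))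
  where
  ≡ᵇ-refl : ∀ n → (n ≡ᵇ n) ≡ true
  ≡ᵇ-refl zero    = refl
  ≡ᵇ-refl (suc n) = ≡ᵇ-refl n

W-- : ∀ m w X v → w v ≡ 0 → W m w X ≤ W m w (X - v)
W-- m w X v wv≡0 = ∑-mono m (λ i _ → pointwise i)
  where
  pointwise : ∀ i → 𝟙 (X i) * w i ≤ 𝟙 ((X - v) i) * w i
  pointwise i with v ≡ᵇ i in eq
  ... | false = 𝟙≤ (X i) (X i ∧ true) (w i) λ x → cong (_∧ true) x
  ... | true  rewrite trans (cong w (sym (≡ᵇ⇒≡ v i (subst T (sym eq) _)))) wv≡0
                    | *-zeroʳ (𝟙 (X i)) = z≤n

-- Locally finite graphs on numbers and Hall's inequality.

module Core (β : ℕ → ℕ) (β-mono : ∀ {m n : ℕ} → m ≤ n → β m ≤ β n) (β-infl : ∀ (m : ℕ) → m ≤ β m) where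

  -- `β m` is thought of as a bound on the neighbours of all vertices below `m`, whence the argument
  -- `suc i` for the single vertex `i`. Both ends are constrained so that the notion is invariant
  -- under `flip`.
  record Bounded (R : Graph) : Set where
    constructor bounded
    field
      bounds : ∀ {i j} → R i j ≡ true → i < β (suc j) × j < β (suc i)

  open Bounded

  flip-bounded : ∀ {R} → Bounded R → Bounded (flip R)
  flip-bounded bd = bounded λ r → swap (bounds bd r)

  ⊑-bounded : ∀ {R S} → R ⊑ S → Bounded S → Bounded R
  ⊑-bounded s bd = bounded λ r → bounds bd (s _ _ r)

  -- The search bound makes membership decidable by a finite search; for a `Bounded` graph it misses
  -- no neighbour.
  N : Graph → (ℕ → Bool) → ℕ → Bool
  N R X j = any< (β (suc j)) (λ i → X i ∧ R i j)

  N-intro : ∀ {R} X → Bounded R → ∀ {i j} → X ∋ i → R i j ≡ true → N R X ∋ j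
  N-intro X bd {i} x r = any<-intro _ i (proj₁ (bounds bd r)) (cong₂ _∧_ x r)

  N-elim : ∀ R X {j} → N R X ∋ j → ∃[ i ] X ∋ i × R i j ≡ true
  N-elim R X {j} p with any<-elim (β (suc j)) p
  ... | i , q = i , ∧-elim q

  N-⊂< : ∀ {R} X {m} → Bounded R → X ⊂< m → N R X ⊂< β m
  N-⊂< {R} X bd X< j p with N-elim R X p
  ... | i , x , r = <-≤-trans (proj₂ (bounds bd r)) (β-mono (X< i x))

  N-mono : ∀ {R S X Y} → Bounded S → R ⊑ S → X ⊆ Y → N R X ⊆ N S Y
  N-mono {R} {X = X} {Y} bd R⊑S X⊆Y j p with N-elim R X p
  ... | i , x , r = N-intro Y bd (X⊆Y i x) (R⊑S i j r)

  Hall : Graph → (ℕ → ℕ) → (ℕ → ℕ) → Set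
  Hall R a b = ∀ m X → X ⊂< m → W m a X ≤ W (β m) b (N R X)

  module _ {R : Graph} {a b : ℕ → ℕ} (bd : Bounded R) where

    -- `Hall` sums over ranges that depend on the set. The lattice identities for `W` need one range
    -- `K` for all sets involved; `hall-at` and `hall-from` pass to it and back.
    hall-at : Hall R a b → ∀ {m K X} → X ⊂< m → β m ≤ K → W K a X ≤ W K b (N R X)
    hall-at hall {m} {K} {X} X< βm≤K = begin
      W K a X              ≡⟨ W-extend a X< (≤-trans (β-infl m) βm≤K) ⟩
      W m a X              ≤⟨ hall m X X< ⟩
      W (β m) b (N R X)    ≤⟨ ∑-≤ _ βm≤K ⟩
      W K b (N R X)        ∎
      where open ≤-Reasoning

    hall-from : ∀ {m K X} → X ⊂< m → β m ≤ K → W K a X ≤ W K b (N R X) →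
                W m a X ≤ W (β m) b (N R X)
    hall-from {m} {K} {X} X< βm≤K le = begin
      W m a X              ≡⟨ W-extend a X< (≤-trans (β-infl m) βm≤K) ⟨
      W K a X              ≤⟨ le ⟩
      W K b (N R X)        ≡⟨ W-extend b (N-⊂< X bd X<) βm≤K ⟩
      W (β m) b (N R X)    ∎
      where open ≤-Reasoning

  hall-mono : ∀ {R S a b c d} → Bounded S → R ⊑ S → (∀ i → c i ≤ a i) → (∀ j → b j ≤ d j) →
              Hall R a b → Hall S c d
  hall-mono {R} {S} {a} {b} {c} {d} bd R⊑S c≤a b≤d hall m X X< = begin
    W m c X              ≤⟨ W-weight m X c≤a ⟩
    W m a X              ≤⟨ hall m X X< ⟩
    W (β m) b (N R X)    ≤⟨ W-⊆ (β m) b (N-mono {X = X} {X} bd R⊑S (λ _ x → x)) ⟩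
    W (β m) b (N S X)    ≤⟨ W-weight (β m) (N S X) b≤d ⟩
    W (β m) d (N S X)    ∎
    where open ≤-Reasoning

  -- Deleting or using a single edge: tight sets and uncrossing.

  Hall₂ : Graph → (ℕ → ℕ) → (ℕ → ℕ) → Set
  Hall₂ R a b = Hall R a b × Hall (flip R) b a

  -- The obstruction to using the edge `(v , u)`: as `X` avoids `v`, its demand stays the same, but
  -- as it sees `u`, its supply drops, and there is nothing to spare. Both sums run over `β m` so
  -- that they can be compared over a common range.
  record Tight (S : Graph) (a b : ℕ → ℕ) (v u : ℕ) : Set where
    field
      m     : ℕ
      X     : ℕ → Bool
      X<    : X ⊂< m
      v∉    : X v ≡ false
      u∈    : N S X ∋ u
      tight : W (β m) b (N S X) ≤ W (β m) a X

    tight-at : Bounded S → ∀ {K} → β m ≤ K → W K b (N S X) ≤ W K a X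
    tight-at bd {K} βm≤K = begin
      W K b (N S X)        ≡⟨ W-extend b (N-⊂< X bd X<) βm≤K ⟩
      W (β m) b (N S X)    ≤⟨ tight ⟩
      W (β m) a X          ≤⟨ ∑-≤ _ βm≤K ⟩
      W K a X              ∎
      where open ≤-Reasoning

  -- S arises from R by deleting (at most) the edge (v , u).
  module Deletion {R S : Graph} {v u : ℕ} (bd : Bounded R) (S⊑R : S ⊑ R)
    (R∖S : ∀ {i j : ℕ} → R i j ≡ true → S i j ≡ true ⊎ (i ≡ v × j ≡ u)) where

    bdS : Bounded S
    bdS = ⊑-bounded S⊑R bd

    bdᵀ : Bounded (flip R)
    bdᵀ = flip-bounded bd

    bdSᵀ : Bounded (flip S)
    bdSᵀ = flip-bounded bdS

    N∌ : ∀ X → X v ≡ false → N R X ⊆ N S X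
    N∌ X v∉ j p with N-elim R X p
    ... | i , x , r with R∖S r
    ...   | inj₁ s          = N-intro X bdS x s
    ...   | inj₂ (refl , _) = ⊥-elim (∌-false x v∉)

    N-off : ∀ X {j} → j ≢ u → N R X ∋ j → N S X ∋ j
    N-off X j≢u p with N-elim R X p
    ... | i , x , r with R∖S r
    ...   | inj₁ s       = N-intro X bdS x s
    ...   | inj₂ (_ , q) = ⊥-elim (j≢u q)

    module _ {a b : ℕ → ℕ} where

      -- Uncrossing of the tight `X` with an arbitrary `Z`, applying Hall's inequality for `R` to
      -- their union and intersection. The deleted edge does no harm: in the union its end `u` is
      -- already in `N S X`, and in the intersection its end `v` does not occur.
      hall-same : Hall R a b → Tight S a b v u → Hall S a b
      hall-same hall t m Z Z< =
        hall-from bdS Z< (β-mono (m≤n⊔m t.m m)) (+-cancelˡ-≤ (W K a X) _ _ (begin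
          W K a X + W K a Z                                      ≡⟨ W-∪∩ K a X Z ⟩
          W K a (X ∪ Z) + W K a (X ∩ Z)                          ≤⟨ +-mono-≤ (hall-at bd hall ∪< ≤-refl) (hall-at bd hall ∩< ≤-refl) ⟩
          W K b (N R (X ∪ Z)) + W K b (N R (X ∩ Z))              ≤⟨ +-mono-≤ (W-⊆ K b N∪) (W-⊆ K b N∩) ⟩
          W K b (N S X ∪ N S Z) + W K b (N S X ∩ N S Z)          ≡⟨ W-∪∩ K b (N S X) (N S Z) ⟨
          W K b (N S X) + W K b (N S Z)                          ≤⟨ +-monoˡ-≤ _ (t.tight-at bdS (β-mono (m≤m⊔n t.m m))) ⟩
          W K a X + W K b (N S Z)                                ∎))
        where
        open ≤-Reasoning
        module t = Tight t
        X = t.X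
        K = β (t.m ⊔ m)
        ∪< : X ∪ Z ⊂< t.m ⊔ m
        ∪< i p with ∪-elim X Z p
        ... | inj₁ x = <-≤-trans (t.X< i x) (m≤m⊔n _ _)
        ... | inj₂ z = <-≤-trans (Z< i z) (m≤n⊔m _ _)
        ∩< : X ∩ Z ⊂< t.m ⊔ m
        ∩< i p = <-≤-trans (t.X< i (proj₁ (∧-elim p))) (m≤m⊔n _ _)
        N∪ : N R (X ∪ Z) ⊆ N S X ∪ N S Z
        N∪ j p with N-elim R (X ∪ Z) p
        ... | i , xz , r with R∖S r
        ...   | inj₂ (_ , refl) = ∪-introˡ (N S X) (N S Z) t.u∈
        ...   | inj₁ s with ∪-elim X Z xz
        ...     | inj₁ x = ∪-introˡ (N S X) (N S Z) (N-intro X bdS x s)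
        ...     | inj₂ z = ∪-introʳ (N S X) (N S Z) (N-intro Z bdS z s)
        N∩ : N R (X ∩ Z) ⊆ N S X ∩ N S Z
        N∩ j p with N-elim R (X ∩ Z) p
        ... | i , xz , r with ∧-elim xz | R∖S r
        ...   | x , z | inj₁ s          = ∩-intro (N S X) (N S Z) (N-intro X bdS x s) (N-intro Z bdS z s)
        ...   | x , _ | inj₂ (refl , _) = ⊥-elim (∌-false x t.v∉)

      -- Here the tight `Y` lies on the right and `Z` on the left, so they are uncrossed by
      -- differences: Hall's inequality for `R` is applied to `Y ∖ NZ`, whose neighbours lie in
      -- `NY ∖ Z`, and to `Z ∖ NY`, whose neighbours lie in `NZ ∖ Y`. The deleted edge meets neither
      -- set, because `u` is not in `Y` and `v` is in `NY`.
      hall-opposite : Hall₂ R a b → Tight (flip S) b a u v → Hall S a b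
      hall-opposite (hall , hallᵀ) t m Z Z< =
        hall-from bdS Z< (≤-trans (β-mono (m≤n⊔m t.m m)) (β-infl _))
          (+-cancelˡ-≤ (W K b Y) _ _ (begin
            W K b Y + W K a Z
              ≡⟨ cong₂ _+_ (W-∩∖ K b Y NZ) (W-∩∖ K a Z NY) ⟩
            (W K b (Y ∩ NZ) + W K b (Y ∖ NZ)) + (W K a (Z ∩ NY) + W K a (Z ∖ NY))
              ≤⟨ +-mono-≤ (+-monoʳ-≤ (W K b (Y ∩ NZ)) Y∖) (+-monoʳ-≤ (W K a (Z ∩ NY)) Z∖) ⟩
            (W K b (Y ∩ NZ) + W K a (NY ∖ Z)) + (W K a (Z ∩ NY) + W K b (NZ ∖ Y))
              ≤⟨ +-mono-≤ (+-monoˡ-≤ _ (W-⊆ K b (∩-comm Y NZ))) (+-monoˡ-≤ _ (W-⊆ K a (∩-comm Z NY))) ⟩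
            (W K b (NZ ∩ Y) + W K a (NY ∖ Z)) + (W K a (NY ∩ Z) + W K b (NZ ∖ Y))
              ≡⟨ exchange (W K b (NZ ∩ Y)) (W K a (NY ∖ Z)) (W K a (NY ∩ Z)) (W K b (NZ ∖ Y)) ⟩
            (W K a (NY ∩ Z) + W K a (NY ∖ Z)) + (W K b (NZ ∩ Y) + W K b (NZ ∖ Y))
              ≡⟨ cong₂ _+_ (W-∩∖ K a NY Z) (W-∩∖ K b NZ Y) ⟨
            W K a NY + W K b NZ
              ≤⟨ +-monoˡ-≤ _ (t.tight-at bdSᵀ (≤-trans (β-mono (m≤m⊔n t.m m)) (β-infl _))) ⟩
            W K b Y + W K b NZ ∎))
        where
        open ≤-Reasoning
        module t = Tight t
        Y = t.X
        M = t.m ⊔ m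
        K = β (β M)
        NY = N (flip S) Y
        NZ = N S Z
        exchange : ∀ p q r s → (p + q) + (r + s) ≡ (r + q) + (p + s)
        exchange = solve-∀
        ∩-comm : ∀ P Q → P ∩ Q ⊆ Q ∩ P
        ∩-comm P Q i p = ∩-intro Q P (proj₂ (∧-elim p)) (proj₁ (∧-elim p))
        Y∖ : W K b (Y ∖ NZ) ≤ W K a (NY ∖ Z)
        Y∖ = ≤-trans
          (hall-at bdᵀ hallᵀ {X = Y ∖ NZ} (λ j p → t.X< j (proj₁ (∖-elim Y NZ p)))
            (≤-trans (β-mono (m≤m⊔n t.m m)) (β-infl _)))
          (W-⊆ K a sub)
          where
          sub : N (flip R) (Y ∖ NZ) ⊆ NY ∖ Z
          sub i p with N-elim (flip R) (Y ∖ NZ) p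
          ... | j , yz , r with ∖-elim Y NZ yz | R∖S r
          ...   | y , _  | inj₂ (_ , refl) = ⊥-elim (∌-false y t.v∉)
          ...   | y , nz | inj₁ s = ∖-intro NY Z (N-intro Y bdSᵀ y s)
                    (≢true λ z → ∌-false (N-intro Z bdS z s) nz)
        Z∖ : W K a (Z ∖ NY) ≤ W K b (NZ ∖ Y)
        Z∖ = ≤-trans
          (hall-at bd hall {X = Z ∖ NY} (λ i p → Z< i (proj₁ (∖-elim Z NY p)))
            (≤-trans (β-mono (m≤n⊔m t.m m)) (β-infl _)))
          (W-⊆ K b sub)
          where
          sub : N R (Z ∖ NY) ⊆ NZ ∖ Y
          sub j p with N-elim R (Z ∖ NY) p
          ... | i , zy , r with ∖-elim Z NY zy | R∖S r
          ...   | _ , ny | inj₂ (refl , _) = ⊥-elim (∌-false t.u∈ ny)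
          ...   | z , ny | inj₁ s = ∖-intro NZ Y (N-intro Z bdS z s)
                    (≢true λ y → ∌-false (N-intro Y bdSᵀ y s) ny)

      -- A vertex `v` of weight 0 can be removed from a left set without changing its weight, and
      -- adds nothing to the weight of a neighbourhood, so its edges are dispensable for both
      -- inequalities.
      hall-exhausted : Hall₂ R a b → a v ≡ 0 → Hall₂ S a b
      hall-exhausted (hall , hallᵀ) av≡0 = left , right
        where
        open ≤-Reasoning
        left : Hall S a b
        left m Z Z< = begin
          W m a Z                ≤⟨ W-- m a Z v av≡0 ⟩
          W m a Z′               ≤⟨ hall m Z′ (λ i p → Z< i (proj₁ (∧-elim p))) ⟩
          W (β m) b (N R Z′)     ≤⟨ W-⊆ (β m) b (λ j p → N-mono {X = Z′} {Z} bdS (λ _ _ s → s) (λ i p → proj₁ (∧-elim p)) j (N∌ Z′ (∉- Z v) j p)) ⟩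
          W (β m) b (N S Z)      ∎
          where
          Z′ = Z - v
        right : Hall (flip S) b a
        right m Y Y< = begin
          W m b Y                     ≤⟨ hallᵀ m Y Y< ⟩
          W (β m) a (N (flip R) Y)    ≤⟨ ∑-mono (β m) (λ i _ → pointwise i) ⟩
          W (β m) a (N (flip S) Y)    ∎
          where
          pointwise : ∀ i → 𝟙 (N (flip R) Y i) * a i ≤ 𝟙 (N (flip S) Y i) * a i
          pointwise i with i ≟ v
          ... | yes refl rewrite av≡0 | *-zeroʳ (𝟙 (N (flip R) Y v)) = z≤n
          ... | no i≢v = 𝟙≤ (N (flip R) Y i) (N (flip S) Y i) (a i) λ p → aux (N-elim (flip R) Y p)
            where
            aux : ∃[ j ] Y ∋ j × R i j ≡ true → N (flip S) Y ∋ i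
            aux (j , t , r) with R∖S r
            ... | inj₁ s       = N-intro Y bdSᵀ t s
            ... | inj₂ (q , _) = ⊥-elim (i≢v q)

      -- Lowering the weights at both ends of the deleted edge costs a set X
      -- avoiding v at most one unit on the right, so only a tight X can fail.
      use-edge∌ : ∀ {a′ b′} → Hall R a b → ¬ Tight S a b v u →
                  (∀ i → a′ i ≤ a i) → (∀ j → j ≢ u → b j ≤ b′ j) → b u ≤ suc (b′ u) →
                  ∀ m X → X ⊂< m → X v ≡ false → W m a′ X ≤ W (β m) b′ (N S X)
      use-edge∌ {a′} {b′} hall ¬tight a′≤a b≤b′ bu≤ m X X< v∉ =
        hall-from bdS X< ≤-refl (≤-trans (W-weight K X a′≤a) (case true? (N S X u) of λ where
          (no  u∉) → ≤-trans base (∑-mono K λ j _ → off u∉ j)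
          (yes u∈) → case W K b (N S X) ≤? W K a X of λ where
            (yes t) → ⊥-elim (¬tight record { X< = X< ; v∉ = v∉ ; u∈ = u∈ ; tight = t })
            (no ¬t) → s≤s⁻¹ (≤-trans (≰⇒> ¬t) (∑-≤-suc K {u}
              (λ j j≢u → *-monoʳ-≤ (𝟙 (N S X j)) (b≤b′ j j≢u)) (at u∈)))))
        where
        K = β m
        base : W K a X ≤ W K b (N S X)
        base = ≤-trans (hall-at bd hall X< ≤-refl) (W-⊆ K b (N∌ X v∉))
        off : ¬ (N S X ∋ u) → ∀ j → 𝟙 (N S X j) * b j ≤ 𝟙 (N S X j) * b′ j
        off u∉ j with j ≟ u
        ... | no  j≢u = *-monoʳ-≤ (𝟙 (N S X j)) (b≤b′ j j≢u)
        ... | yes refl rewrite ≢true u∉ = z≤n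
        at : N S X ∋ u → 𝟙 (N S X u) * b u ≤ suc (𝟙 (N S X u) * b′ u)
        at u∈ rewrite u∈ | +-identityʳ (b u) | +-identityʳ (b′ u) = bu≤

  module _ {R S : Graph} {v u : ℕ} (bd : Bounded R) (S⊑R : S ⊑ R)
    (R∖S : ∀ {i j : ℕ} → R i j ≡ true → S i j ≡ true ⊎ (i ≡ v × j ≡ u)) where

    private
      module D  = Deletion bd S⊑R R∖S
      module Dᵀ = Deletion (flip-bounded bd) (λ i j → S⊑R j i) (λ r → map₂ swap (R∖S r))

    hall₂-exhausted : ∀ {a b} → Hall₂ R a b → a v ≡ 0 ⊎ b u ≡ 0 → Hall₂ S a b
    hall₂-exhausted hall (inj₁ av≡0) = D.hall-exhausted hall av≡0
    hall₂-exhausted hall (inj₂ bu≡0) = swap (Dᵀ.hall-exhausted (swap hall) bu≡0)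

    drop-edge : ∀ {a b} → Hall₂ R a b → Tight S a b v u ⊎ Tight (flip S) b a u v → Hall₂ S a b
    drop-edge hall (inj₁ t) = D.hall-same (proj₁ hall) t , Dᵀ.hall-opposite (swap hall) t
    drop-edge hall (inj₂ t) = D.hall-opposite hall t , Dᵀ.hall-same (proj₂ hall) t

    -- A left set containing `v` loses one unit of demand, and at most one unit of supply: `u` has
    -- weight 1 before and 0 after, so losing `u` as a neighbour costs nothing beyond that unit. A
    -- right set may be replaced by its part without `u`, as `u` no longer weighs anything. Sets
    -- that avoid the end on their own side are left to the absence of tight sets.
    use-edge : ∀ {a b a′ b′} → Hall₂ R a b → ¬ (Tight S a b v u ⊎ Tight (flip S) b a u v) →
               a v ≡ suc (a′ v) → (∀ i → i ≢ v → a i ≡ a′ i) →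
               b u ≡ suc (b′ u) → b′ u ≡ 0 → (∀ j → j ≢ u → b j ≡ b′ j) →
               Hall₂ S a′ b′
    use-edge {a} {b} {a′} {b′} hall@(hallL , _) ¬tight av a≈ bu b′u b≈ = left , right
      where
      open ≤-Reasoning
      a′≤a : ∀ i → a′ i ≤ a i
      a′≤a i with i ≟ v
      ... | yes refl rewrite av = n≤1+n _
      ... | no  i≢v  = ≤-reflexive (sym (a≈ i i≢v))
      b′≤b : ∀ j → b′ j ≤ b j
      b′≤b j with j ≟ u
      ... | yes refl rewrite bu = n≤1+n _
      ... | no  j≢u  = ≤-reflexive (sym (b≈ j j≢u))
      left : Hall S a′ b′
      left m X X< with X v in eq
      ... | false = D.use-edge∌ hallL (λ t → ¬tight (inj₁ t)) a′≤a
                      (λ j j≢u → ≤-reflexive (b≈ j j≢u)) (≤-reflexive bu) m X X< eq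
      ... | true  = hall-from D.bdS X< ≤-refl (s≤s⁻¹ (begin
        suc (W K a′ X)           ≤⟨ ∑-suc-≤ (<-≤-trans (X< v eq) (β-infl m))
                                      (λ i _ → *-monoʳ-≤ (𝟙 (X i)) (a′≤a i)) at-v ⟩
        W K a X                  ≤⟨ hall-at bd hallL X< ≤-refl ⟩
        W K b (N R X)            ≤⟨ ∑-≤-suc K off-u at-u ⟩
        suc (W K b′ (N S X))     ∎))
        where
        K = β m
        at-v : suc (𝟙 (X v) * a′ v) ≤ 𝟙 (X v) * a v
        at-v rewrite eq | av | +-identityʳ (a′ v) = ≤-refl
        off-u : ∀ j → j ≢ u → 𝟙 (N R X j) * b j ≤ 𝟙 (N S X j) * b′ j
        off-u j j≢u rewrite b≈ j j≢u = 𝟙≤ (N R X j) (N S X j) (b′ j) (D.N-off X j≢u)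
        at-u : 𝟙 (N R X u) * b u ≤ suc (𝟙 (N S X u) * b′ u)
        at-u rewrite bu | b′u | *-zeroʳ (𝟙 (N S X u)) | *-identityʳ (𝟙 (N R X u)) with N R X u
        ... | true  = ≤-refl
        ... | false = z≤n
      right : Hall (flip S) b′ a′
      right m Y Y< = begin
        W m b′ Y                          ≤⟨ W-- m b′ Y u b′u ⟩
        W m b′ (Y - u)                    ≤⟨ Dᵀ.use-edge∌ (proj₂ hall) (λ t → ¬tight (inj₂ t)) b′≤b
                                               (λ i i≢v → ≤-reflexive (a≈ i i≢v)) (≤-reflexive av)
                                               m (Y - u) (λ j p → Y< j (proj₁ (∧-elim p))) (∉- Y u) ⟩
        W (β m) a′ (N (flip S) (Y - u))   ≤⟨ W-⊆ (β m) a′ (N-mono {X = Y - u} {Y} Dᵀ.bdS (λ _ _ s → s) (λ j p → proj₁ (∧-elim p))) ⟩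
        W (β m) a′ (N (flip S) Y)         ∎

  -- Expansion, layers and the reduction of Hall's inequality to a bounded region.

  Expanding : Graph → (ℕ → ℕ) → (ℕ → ℕ) → (ℕ → ℕ) → Set
  Expanding R a b h = ∀ m X n → X ⊂< m → h n ≤ W m a X → W m a X + n ≤ W (β m) b (N R X)

  expanding-hall : ∀ {R a b h} → h 0 ≡ 0 → Expanding R a b h → Hall R a b
  expanding-hall h0 ex m X X< =
    subst (_≤ _) (+-identityʳ _) (ex m X 0 X< (subst (_≤ _) (sym h0) z≤n))

  -- Two applications of `β` per layer: vertices below `p` have neighbours below `β p`, and vertices
  -- from `β (β p)` on have neighbours from `β p` on. A layer without weight thus separates
  -- neighbourhoods as well as sets.
  layer : ℕ → ℕ → ℕ
  layer n s = natrec n (λ _ r → β (β r)) s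

  layer-step : ∀ n s → layer n s ≤ layer n (suc s)
  layer-step n s = ≤-trans (β-infl _) (β-infl _)

  layer-mono : ∀ n {r s} → r ≤ s → layer n r ≤ layer n s
  layer-mono n {s = zero}  z≤n = ≤-refl
  layer-mono n {s = suc s} r≤s with m≤n⇒m<n∨m≡n r≤s
  ... | inj₁ (s≤s r≤) = ≤-trans (layer-mono n r≤) (layer-step n s)
  ... | inj₂ refl     = ≤-refl

  -- Every layer on which `f` does not vanish raises the total by at least one, so `s` layers
  -- without a gap accumulate at least `s`.
  gap-or-large : ∀ n f s →
    (∃[ r ] r < s × (∀ i → layer n r ≤ i → i < layer n (suc r) → f i ≡ 0)) ⊎ s ≤ ∑ (layer n s) f
  gap-or-large n f zero = inj₂ z≤n
  gap-or-large n f (suc s) with gap-or-large n f s | ∑ (layer n (suc s)) f ≤? ∑ (layer n s) f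
  ... | inj₁ (r , r<s , gap) | _      = inj₁ (r , m<n⇒m<1+n r<s , gap)
  ... | inj₂ _               | yes le = inj₁ (s , ≤-refl , ∑-gap (layer-step n s) le)
  ... | inj₂ large           | no ¬le = inj₂ (≤-trans (s≤s large) (≰⇒> ¬le))

  -- A set of small weight has no weight in some layer [layer r , layer (r+1));
  -- the parts below and above it have disjoint neighbourhoods, and the part
  -- above does not see the difference between (S , a , b) and (R , wA , wB).
  localise : ∀ {R S wA wB a b h} n s → Bounded R → S ⊑ R →
    (∀ i j → n ≤ j → R i j ≡ true → S i j ≡ true) →
    (∀ i → a i ≤ wA i) → (∀ j → n ≤ j → wB j ≤ b j) →
    h 0 ≡ 0 → Expanding R wA wB h → h (∑ n wB) ≤ s →
    (∀ X → X ⊂< layer n s → W (layer n s) a X ≤ W (β (layer n s)) b (N S X)) →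
    Hall S a b
  localise {R} {S} {wA} {wB} {a} {b} {h} n s bd S⊑R R⊑S a≤wA wB≤b h0 ex hs≤s local m X X<
    with gap-or-large n (λ i → 𝟙 (X i) * wA i) s
  -- Expansion with surplus `D` pays for the right vertices below `n`, the only ones where edges or
  -- weight may have been lost; their total weight is at most `D`.
  ... | inj₂ large = +-cancelˡ-≤ D _ _ (begin
      D + W m a X                          ≡⟨ +-comm D _ ⟩
      W m a X + D                          ≤⟨ +-monoˡ-≤ D (W-weight m X a≤wA) ⟩
      W m wA X + D                         ≤⟨ ex m X D X< (≤-trans hs≤s (≤-trans large below-m)) ⟩
      W (β m) wB (N R X)                   ≤⟨ ∑-mono (β m) (λ j _ → pointwise j) ⟩
      ∑ (β m) (λ j → 𝟙 (below j) * wB j + 𝟙 (N S X j) * b j)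
                                           ≡⟨ ∑-+ (β m) _ _ ⟩
      W (β m) wB below + W (β m) b (N S X) ≤⟨ +-monoˡ-≤ _ below-D ⟩
      D + W (β m) b (N S X)                ∎)
    where
    open ≤-Reasoning
    D = ∑ n wB
    below : ℕ → Bool
    below j = suc j ≤ᵇ n
    below-m : W (layer n s) wA X ≤ W m wA X
    below-m = ≤-trans (∑-≤ _ (m≤n⊔m m (layer n s))) (≤-reflexive (W-extend wA X< (m≤m⊔n m (layer n s))))
    below-D : W (β m) wB below ≤ D
    below-D = begin
      W (β m) wB below        ≤⟨ ∑-≤ _ (m≤m⊔n (β m) n) ⟩
      W (β m ⊔ n) wB below    ≡⟨ W-extend wB {below} (λ j → ≤ᵇ-≤) (m≤n⊔m (β m) n) ⟩
      W n wB below            ≤⟨ ∑-mono n (λ j _ → 𝟙*≤ (below j) (wB j)) ⟩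
      D                       ∎
      where
      𝟙*≤ : ∀ x k → 𝟙 x * k ≤ k
      𝟙*≤ true  k = ≤-reflexive (+-identityʳ k)
      𝟙*≤ false k = z≤n
    pointwise : ∀ j → 𝟙 (N R X j) * wB j ≤ 𝟙 (below j) * wB j + 𝟙 (N S X j) * b j
    pointwise j with n ≤? j
    ... | no n≰j rewrite ≤ᵇ-true (≰⇒> n≰j) =
      ≤-trans (𝟙≤ (N R X j) true (wB j) (λ _ → refl)) (m≤m+n _ _)
    ... | yes n≤j = ≤-trans (≤-trans (𝟙≤ (N R X j) (N S X j) (wB j) back)
                      (*-monoʳ-≤ (𝟙 (N S X j)) (wB≤b j n≤j))) (m≤n+m _ _)
      where
      back : N R X ∋ j → N S X ∋ j
      back p with N-elim R X p
      ... | i , x , r = N-intro X (⊑-bounded S⊑R bd) x (R⊑S i j n≤j r)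
  ... | inj₁ (r , r<s , gap) =
    hall-from bdS X< (β-mono (m≤m⊔n m L)) (begin
      W K a X                              ≤⟨ ∑-mono K (λ i _ → split i) ⟩
      ∑ K (λ i → 𝟙 (X₁ i) * a i + 𝟙 (X₂ i) * a i)
                                           ≡⟨ ∑-+ K _ _ ⟩
      W K a X₁ + W K a X₂                  ≤⟨ +-mono-≤ near far ⟩
      W K b (N S X₁) + W K b (N S X₂)      ≡⟨ ∑-+ K _ _ ⟨
      ∑ K (λ j → 𝟙 (N S X₁ j) * b j + 𝟙 (N S X₂ j) * b j)
                                           ≤⟨ ∑-mono K (λ j _ → merge j) ⟩
      W K b (N S X)                        ∎)
    where
    open ≤-Reasoning
    L = layer n s
    p = layer n r
    q = layer n (suc r)
    K = β (m ⊔ L)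
    bdS = ⊑-bounded S⊑R bd
    X₁ X₂ : ℕ → Bool
    X₁ i = X i ∧ (suc i ≤ᵇ p)
    X₂ i = X i ∧ (q ≤ᵇ i)
    X₁⊂<p : X₁ ⊂< p
    X₁⊂<p i x = ≤ᵇ-≤ (proj₂ (∧-elim x))
    X₁⊂<L : X₁ ⊂< L
    X₁⊂<L i x = <-≤-trans (X₁⊂<p i x) (layer-mono n (<⇒≤ r<s))
    X₂⊂<m : X₂ ⊂< m
    X₂⊂<m i x = X< i (proj₁ (∧-elim x))
    N₂≥ : ∀ {j} → N R X₂ ∋ j → β p ≤ j
    N₂≥ {j} y with N-elim R X₂ y
    ... | i , x , e with β p ≤? j
    ...   | yes le = le
    ...   | no ¬le = ⊥-elim (<⇒≱ (<-≤-trans (proj₁ (bounds bd e)) (β-mono (≰⇒> ¬le)))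
                                 (≤ᵇ-≤ {q} (proj₂ (∧-elim x))))
    split : ∀ i → 𝟙 (X i) * a i ≤ 𝟙 (X₁ i) * a i + 𝟙 (X₂ i) * a i
    split i with i <? p
    ... | yes i<p rewrite ≤ᵇ-true i<p | ∧-identityʳ (X i) = m≤m+n _ _
    ... | no  i≮p with q ≤? i
    ...   | yes q≤i rewrite ≤ᵇ-true q≤i | ∧-identityʳ (X i) = m≤n+m _ _
    ...   | no  q≰i = ≤-trans (*-monoʳ-≤ (𝟙 (X i)) (a≤wA i))
                        (≤-trans (≤-reflexive (gap i (≮⇒≥ i≮p) (≰⇒> q≰i))) z≤n)
    near : W K a X₁ ≤ W K b (N S X₁)
    near = begin
      W K a X₁               ≡⟨ W-extend a X₁⊂<L (≤-trans (m≤n⊔m m L) (β-infl _)) ⟩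
      W L a X₁               ≤⟨ local X₁ X₁⊂<L ⟩
      W (β L) b (N S X₁)     ≤⟨ ∑-≤ _ (β-mono (m≤n⊔m m L)) ⟩
      W K b (N S X₁)         ∎
    far : W K a X₂ ≤ W K b (N S X₂)
    far = begin
      W K a X₂               ≤⟨ W-weight K X₂ a≤wA ⟩
      W K wA X₂              ≤⟨ hall-at bd (expanding-hall h0 ex) X₂⊂<m (β-mono (m≤m⊔n m L)) ⟩
      W K wB (N R X₂)        ≤⟨ ∑-mono K (λ j _ → unchanged j) ⟩
      W K b (N S X₂)         ∎
      where
      unchanged : ∀ j → 𝟙 (N R X₂ j) * wB j ≤ 𝟙 (N S X₂ j) * b j
      unchanged j with N R X₂ j in eq
      ... | false = z≤n
      ... | true with N-elim R X₂ eq | ≤-trans (layer-mono n {0} {r} z≤n) (≤-trans (β-infl p) (N₂≥ eq))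
      ...   | i , x , e | n≤j rewrite N-intro X₂ bdS x (R⊑S i j n≤j e) = *-monoʳ-≤ 1 (wB≤b j n≤j)
    merge : ∀ j → 𝟙 (N S X₁ j) * b j + 𝟙 (N S X₂ j) * b j ≤ 𝟙 (N S X j) * b j
    merge j with N S X₁ j in eq₁
    ... | false = 𝟙≤ (N S X₂ j) (N S X j) (b j)
                    (N-mono {X = X₂} {X} bdS (λ _ _ e → e) (λ i x → proj₁ (∧-elim x)) j)
    ... | true with N S X₂ j in eq₂
    ...   | true  = ⊥-elim (<⇒≱ (N-⊂< X₁ bdS X₁⊂<p j eq₁) (N₂≥ (N-mono {X = X₂} {X₂} bd S⊑R (λ _ x → x) j eq₂)))
    ...   | false rewrite N-mono {X = X₁} {X} bdS (λ _ _ e → e) (λ i x → proj₁ (∧-elim x)) j eq₁ =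
      ≤-reflexive (+-identityʳ _)

  -- Degrees, remaining weights and the finite Hall test.

  deg : Graph → ℕ → ℕ
  deg C i = ∑ (β (suc i)) (λ j → 𝟙 (C i j))

  rest : (ℕ → ℕ) → Graph → ℕ → ℕ
  rest w C i = w i ∸ deg C i

  deg-cong : ∀ C D i → (∀ j → C i j ≡ D i j) → deg C i ≡ deg D i
  deg-cong C D i eq = ∑-cong (β (suc i)) (λ j _ → cong 𝟙 (eq j))

  deg-suc : ∀ C D {v u} → u < β (suc v) → C v u ≡ false → D v u ≡ true →
            (∀ j → j ≢ u → C v j ≡ D v j) → deg D v ≡ suc (deg C v)
  deg-suc C D {v} {u} u< Cvu Dvu eq = ≤-antisym
    (∑-≤-suc (β (suc v)) {u} (λ j j≢u → ≤-reflexive (cong 𝟙 (sym (eq j j≢u)))) at-D)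
    (∑-suc-≤ u< (λ j j≢u → ≤-reflexive (cong 𝟙 (eq j j≢u))) at-C)
    where
    at-D : 𝟙 (D v u) ≤ suc (𝟙 (C v u))
    at-D rewrite Cvu | Dvu = ≤-refl
    at-C : suc (𝟙 (C v u)) ≤ 𝟙 (D v u)
    at-C rewrite Cvu | Dvu = ≤-refl

  hall-isolated : ∀ {S a b} → Hall S a b → ∀ i → (∀ j → S i j ≡ false) → a i ≡ 0
  hall-isolated {S} {a} {b} hall i isolated = n≤0⇒n≡0 (begin
    a i                                   ≡⟨ +-identityʳ (a i) ⟨
    1 * a i                               ≡⟨ cong (_* a i) (δ-diag i) ⟨
    δ i i * a i                           ≤⟨ term≤∑ (λ j → δ i j * a j) ≤-refl ⟩
    W (suc i) a (i ≡ᵇ_)                   ≤⟨ hall (suc i) (i ≡ᵇ_) (λ j p → s≤s (≤-reflexive (sym (≡-of j p)))) ⟩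
    W (β (suc i)) b (N S (i ≡ᵇ_))         ≡⟨ ∑-zero (β (suc i)) (λ j _ → empty j) ⟩
    0                                     ∎)
    where
    open ≤-Reasoning
    ≡-of : ∀ j → (i ≡ᵇ j) ≡ true → i ≡ j
    ≡-of j p = ≡ᵇ⇒≡ i j (subst T (sym p) _)
    empty : ∀ j → 𝟙 (N S (i ≡ᵇ_) j) * b j ≡ 0
    empty j with N S (i ≡ᵇ_) j in eq
    ... | false = refl
    ... | true with N-elim S (i ≡ᵇ_) eq
    ...   | i′ , p , s rewrite sym (≡-of i′ p) = ⊥-elim (∌-false s (isolated j))

  -- The second conjunct confines the set to numbers below `L` by definition, whatever the code `c`.
  subset : ℕ → ℕ → ℕ → Bool
  subset L c i = bit i c ∧ (suc i ≤ᵇ L)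

  hallTest : Graph → (ℕ → ℕ) → (ℕ → ℕ) → ℕ → Bool
  hallTest S a b L = all< (2 ^ L) (λ c → W L a (subset L c) ≤ᵇ W (β L) b (N S (subset L c)))

  hall⇒test : ∀ {S a b} → Hall S a b → ∀ L → hallTest S a b L ≡ true
  hall⇒test hall L = all<-intro (2 ^ L) λ c _ →
    ≤ᵇ-true (hall L (subset L c) (λ i p → ≤ᵇ-≤ (proj₂ (∧-elim p))))

  test⇒hall : ∀ {S a b L} → Bounded S → hallTest S a b L ≡ true →
              ∀ X → X ⊂< L → W L a X ≤ W (β L) b (N S X)
  test⇒hall {S} {a} {b} {L} bd test X X< with bits-surjective L X
  ... | c , c< , bits = begin
    W L a X                     ≤⟨ W-⊆ L a (λ i x → cong₂ _∧_ (trans (bits i (X< i x)) x) (≤ᵇ-true (X< i x))) ⟩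
    W L a (subset L c)          ≤⟨ ≤ᵇ-≤ (all<-elim (2 ^ L) test c c<) ⟩
    W (β L) b (N S (subset L c)) ≤⟨ W-⊆ (β L) b (N-mono {X = subset L c} {X} bd (λ _ _ s → s) back) ⟩
    W (β L) b (N S X)           ∎
    where
    open ≤-Reasoning
    back : subset L c ⊆ X
    back i p with ∧-elim p
    ... | p₁ , p₂ = trans (sym (bits i (≤ᵇ-≤ p₂))) p₁

  undecided : Graph → (ℕ → ℕ → ℕ) → ℕ → Graph
  undecided R π n i j = R i j ∧ (n ≤ᵇ π i j)

  -- The conjunct `R i j` makes decisions on numbers that code no edge harmless.
  chosen : Graph → (ℕ → ℕ → ℕ) → ℕ → (ℕ → Bool) → Graph
  chosen R π n M i j = R i j ∧ ((suc (π i j) ≤ᵇ n) ∧ M (π i j))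

  -- The run of decisions, its invariant and its limit.

  module Matching (R : Graph) (bd : Bounded R) (wA wB : ℕ → ℕ) (wB≤1 : ∀ (j : ℕ) → wB j ≤ 1)
    (h : ℕ → ℕ) (h0 : h 0 ≡ 0) (exA : Expanding R wA wB h) (exB : Expanding (flip R) wB wA h) where

    U : ℕ → Graph
    U = undecided R pair

    C : ℕ → (ℕ → Bool) → Graph
    C = chosen R pair

    a b : ℕ → (ℕ → Bool) → ℕ → ℕ
    a n M = rest wA (C n M)
    b n M = rest wB (flip (C n M))

    -- `rest` is a truncated subtraction, so a vertex with too many chosen edges would look exactly
    -- satisfied; `fitsA` and `fitsB` exclude this.
    record Good (n : ℕ) (M : ℕ → Bool) : Set where
      constructor good
      field
        fitsA : ∀ i → deg (C n M) i ≤ wA i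
        fitsB : ∀ j → deg (flip (C n M)) j ≤ wB j
        hall  : Hall₂ (U n) (a n M) (b n M)

    U⊑R : ∀ n → U n ⊑ R
    U⊑R n i j p = proj₁ (∧-elim p)

    bdU : ∀ n → Bounded (U n)
    bdU n = ⊑-bounded (U⊑R n) bd

    U-step : ∀ n → U (suc n) ⊑ U n
    U-step n i j p with ∧-elim p
    ... | r , n<π = cong₂ _∧_ r (≤ᵇ-true (<⇒≤ (≤ᵇ-≤ {suc n} n<π)))

    U-case : ∀ {n i j} → U n i j ≡ true → U (suc n) i j ≡ true ⊎ pair i j ≡ n
    U-case {n} {i} {j} p with ∧-elim p
    ... | r , n≤π with m≤n⇒m<n∨m≡n (≤ᵇ-≤ {n} n≤π)
    ...   | inj₁ n<π = inj₁ (cong₂ _∧_ r (≤ᵇ-true n<π))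
    ...   | inj₂ n≡π = inj₂ (sym n≡π)

    module _ {n : ℕ} {M M′ : ℕ → Bool} (agree : ∀ (m : ℕ) → m < n → M′ m ≡ M m) where

      C-off : ∀ i j → pair i j ≢ n → C (suc n) M′ i j ≡ C n M i j
      C-off i j π≢n with <-cmp (pair i j) n
      ... | tri< π<n _ _ rewrite ≤ᵇ-true (m<n⇒m<1+n π<n) | ≤ᵇ-true π<n | agree (pair i j) π<n = refl
      ... | tri≈ _ π≡n _ = ⊥-elim (π≢n π≡n)
      ... | tri> _ _ n<π rewrite ≤ᵇ-false (s≤s n<π) | ≤ᵇ-false {suc (pair i j)} {n} (m<n⇒m<1+n n<π) = refl

      C-at-old : ∀ {i j} → pair i j ≡ n → C n M i j ≡ false
      C-at-old {i} {j} refl rewrite ≤ᵇ-false {suc (pair i j)} ≤-refl = ∧-zeroʳ (R i j)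

      C-at-new : ∀ {i j} → pair i j ≡ n → C (suc n) M′ i j ≡ R i j ∧ M′ n
      C-at-new {i} {j} refl rewrite ≤ᵇ-true {suc (pair i j)} ≤-refl = refl

      C-reject : M′ n ≡ false → ∀ i j → C (suc n) M′ i j ≡ C n M i j
      C-reject rej i j with pair i j ≟ n
      ... | no  π≢n = C-off i j π≢n
      ... | yes π≡n rewrite C-at-new {i} {j} π≡n | C-at-old {i} {j} π≡n | rej = ∧-zeroʳ (R i j)

    module _ {n : ℕ} {M M₀ M₁ : ℕ → Bool}
      (agree₀ : ∀ (m : ℕ) → m < n → M₀ m ≡ M m) (rej : M₀ n ≡ false)
      (agree₁ : ∀ (m : ℕ) → m < n → M₁ m ≡ M m) (acc : M₁ n ≡ true) where

      good-accept : ∀ {v u} → R v u ≡ true → pair v u ≡ n → Good n M →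
                    a n M v ≢ 0 → b n M u ≢ 0 →
                    ¬ (Tight (U (suc n)) (a n M) (b n M) v u ⊎ Tight (flip (U (suc n))) (b n M) (a n M) u v) →
                    Good (suc n) M₁
      good-accept {v} {u} r π≡n (good fitsA fitsB hall) av≢0 bu≢0 ¬tight = good fitsA′ fitsB′
        (use-edge (bdU n) (U-step n) only-edge hall ¬tight
          (rest-v av>0 degA-v) (λ i i≢v → cong (wA i ∸_) (sym (degA-off i i≢v)))
          (rest-v bu>0 degB-u)
          -- Since `wB` is at most 1, the accepted edge saturates `u`, as `use-edge` demands.
          (m≤n⇒m∸n≡0 (≤-trans (wB≤1 u) (subst (1 ≤_) (sym degB-u) (s≤s z≤n))))
          (λ j j≢u → cong (wB j ∸_) (sym (degB-off j j≢u))))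
        where
        only-edge : ∀ {i j} → U n i j ≡ true → U (suc n) i j ≡ true ⊎ (i ≡ v × j ≡ u)
        only-edge {i} {j} p = map₂ (λ eq → pair-injective {i} {j} (trans eq (sym π≡n))) (U-case {n} {i} {j} p)
        off : ∀ i j → ¬ (i ≡ v × j ≡ u) → C (suc n) M₁ i j ≡ C n M i j
        off i j ¬e = C-off agree₁ i j (λ eq → ¬e (pair-injective {i} {j} (trans eq (sym π≡n))))
        new : C (suc n) M₁ v u ≡ true
        new = trans (C-at-new agree₁ {v} {u} π≡n) (cong₂ _∧_ r acc)
        old : C n M v u ≡ false
        old = C-at-old agree₁ {v} {u} π≡n
        degA-v : deg (C (suc n) M₁) v ≡ suc (deg (C n M) v)
        degA-v = deg-suc (C n M) (C (suc n) M₁) (proj₂ (bounds bd r)) old new (λ j j≢u → sym (off v j (j≢u ∘ proj₂)))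
        degA-off : ∀ i → i ≢ v → deg (C (suc n) M₁) i ≡ deg (C n M) i
        degA-off i i≢v = deg-cong (C (suc n) M₁) (C n M) i (λ j → off i j (i≢v ∘ proj₁))
        degB-u : deg (flip (C (suc n) M₁)) u ≡ suc (deg (flip (C n M)) u)
        degB-u = deg-suc (flip (C n M)) (flip (C (suc n) M₁)) (proj₁ (bounds bd r)) old new (λ i i≢v → sym (off i u (i≢v ∘ proj₁)))
        degB-off : ∀ j → j ≢ u → deg (flip (C (suc n) M₁)) j ≡ deg (flip (C n M)) j
        degB-off j j≢u = deg-cong (flip (C (suc n) M₁)) (flip (C n M)) j (λ i → off i j (j≢u ∘ proj₂))
        av>0 : deg (C n M) v < wA v
        av>0 = m∸n≢0⇒n<m av≢0
        bu>0 : deg (flip (C n M)) u < wB u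
        bu>0 = m∸n≢0⇒n<m bu≢0
        rest-v : ∀ {d e w} → d < w → e ≡ suc d → w ∸ d ≡ suc (w ∸ e)
        rest-v {w = suc w} (s≤s d≤w) refl = +-∸-assoc 1 d≤w
        fitsA′ : ∀ i → deg (C (suc n) M₁) i ≤ wA i
        fitsA′ i with i ≟ v
        ... | yes refl rewrite degA-v = av>0
        ... | no  i≢v rewrite degA-off i i≢v = fitsA i
        fitsB′ : ∀ j → deg (flip (C (suc n) M₁)) j ≤ wB j
        fitsB′ j with j ≟ u
        ... | yes refl rewrite degB-u = bu>0
        ... | no  j≢u rewrite degB-off j j≢u = fitsB j

      degA₀ : ∀ i → deg (C (suc n) M₀) i ≡ deg (C n M) i
      degA₀ i = deg-cong (C (suc n) M₀) (C n M) i (C-reject agree₀ rej i)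

      degB₀ : ∀ j → deg (flip (C (suc n) M₀)) j ≡ deg (flip (C n M)) j
      degB₀ j = deg-cong (flip (C (suc n) M₀)) (flip (C n M)) j (λ i → C-reject agree₀ rej i j)

      -- Suppose the inequality failed after discarding. Then, if `n` coded an edge, neither end
      -- would be exhausted and no set would be tight, so accepting would have been good. Hence `n`
      -- codes no edge, nothing was discarded, and the inequality holds after all. Whether a tight
      -- set exists is not decided, whence the double negation.
      reject-hall : Good n M → ¬ Good (suc n) M₁ → ¬ ¬ Hall₂ (U (suc n)) (a n M) (b n M)
      reject-hall g ¬g₁ ¬hall = ¬hall (hall-mono (bdU (suc n)) U⊑ (λ _ → ≤-refl) (λ _ → ≤-refl) (proj₁ hall)
                                      , hall-mono (flip-bounded (bdU (suc n))) (λ j i → U⊑ i j) (λ _ → ≤-refl) (λ _ → ≤-refl) (proj₂ hall))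
        where
        open Good g
        no-edge : ∀ {v u} → R v u ≡ true → pair v u ≢ n
        no-edge {v} {u} r π≡n = ¬hall (case (a n M v ≟ 0) ,′ (b n M u ≟ 0) of λ where
            (yes av≡0 , _)        → hall₂-exhausted (bdU n) (U-step n) only-edge hall (inj₁ av≡0)
            (no _ , yes bu≡0)     → hall₂-exhausted (bdU n) (U-step n) only-edge hall (inj₂ bu≡0)
            (no av≢0 , no bu≢0)   → ⊥-elim (¬g₁ (good-accept r π≡n g av≢0 bu≢0
                                      (λ t → ¬hall (drop-edge (bdU n) (U-step n) only-edge hall t)))))
          where
          only-edge : ∀ {i j} → U n i j ≡ true → U (suc n) i j ≡ true ⊎ (i ≡ v × j ≡ u)
          only-edge {i} {j} p = map₂ (λ eq → pair-injective {i} {j} (trans eq (sym π≡n))) (U-case {n} {i} {j} p)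
        U⊑ : U n ⊑ U (suc n)
        U⊑ i j p with U-case {n} {i} {j} p
        ... | inj₁ q   = q
        ... | inj₂ π≡n = ⊥-elim (no-edge (proj₁ (∧-elim p)) π≡n)

      good-reject : Good n M → ¬ Good (suc n) M₁ → Good (suc n) M₀
      good-reject g ¬g₁ = good
        (λ i → subst (_≤ wA i) (sym (degA₀ i)) (fitsA i))
        (λ j → subst (_≤ wB j) (sym (degB₀ j)) (fitsB j))
        -- For a fixed set the claim is a decidable comparison, so the double negation can be
        -- removed instance by instance.
        ( (λ m X X< → decidable-stable (_ ≤? _) λ ¬p → reject-hall g ¬g₁ λ hs →
             ¬p (hall-mono (bdU (suc n)) (λ _ _ e → e) a₀≤ ≤b₀ (proj₁ hs) m X X<))
        , (λ m Y Y< → decidable-stable (_ ≤? _) λ ¬p → reject-hall g ¬g₁ λ hs →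
             ¬p (hall-mono (flip-bounded (bdU (suc n))) (λ _ _ e → e) b₀≤ ≤a₀ (proj₂ hs) m Y Y<)))
        where
        open Good g
        a₀≤ = λ i → ≤-reflexive (cong (wA i ∸_) (degA₀ i))
        ≤a₀ = λ i → ≤-reflexive (cong (wA i ∸_) (sym (degA₀ i)))
        b₀≤ = λ j → ≤-reflexive (cong (wB j ∸_) (degB₀ j))
        ≤b₀ = λ j → ≤-reflexive (cong (wB j ∸_) (sym (degB₀ j)))

    -- Left sets need the threshold for the weight lost on the right, and right sets the threshold
    -- for the weight lost on the left; the sum serves both.
    size : ℕ → ℕ
    size n = layer n (h (∑ n wA) + h (∑ n wB))

    -- Degrees are compared only below `n`: edges at later vertices have numbers at least `n`, so
    -- none of them is chosen yet.
    test : ℕ → (ℕ → Bool) → Bool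
    test n M =
      (all< n (λ i → deg (C n M) i ≤ᵇ wA i) ∧ all< n (λ j → deg (flip (C n M)) j ≤ᵇ wB j)) ∧
      (hallTest (U n) (a n M) (b n M) (size n) ∧ hallTest (flip (U n)) (b n M) (a n M) (size n))

    good⇒test : ∀ {n M} → Good n M → test n M ≡ true
    good⇒test {n} (good fitsA fitsB (hallL , hallR)) = cong₂ _∧_
      (cong₂ _∧_ (all<-intro n (λ i _ → ≤ᵇ-true (fitsA i))) (all<-intro n (λ j _ → ≤ᵇ-true (fitsB j))))
      (cong₂ _∧_ (hall⇒test hallL (size n)) (hall⇒test hallR (size n)))

    test⇒good : ∀ {n M} → test n M ≡ true → Good n M
    test⇒good {n} {M} p with ∧-elim p
    ... | fits , halls with ∧-elim fits | ∧-elim halls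
    ...   | fA , fB | tL , tR = good
      (λ i → case i <? n of λ where
        (yes i<n) → ≤ᵇ-≤ (all<-elim n fA i i<n)
        (no  i≮n) → subst (_≤ wA i) (sym (degA-far i (≮⇒≥ i≮n))) z≤n)
      (λ j → case j <? n of λ where
        (yes j<n) → ≤ᵇ-≤ (all<-elim n fB j j<n)
        (no  j≮n) → subst (_≤ wB j) (sym (degB-far j (≮⇒≥ j≮n))) z≤n)
      ( localise n (h (∑ n wA) + h (∑ n wB)) bd (U⊑R n) (λ i j n≤j r → U-far {i} {j} r (≤-trans n≤j (pair-≥ʳ i j)))
          (λ i → m∸n≤m (wA i) (deg (C n M) i)) (λ j n≤j → ≤-reflexive (sym (cong (wB j ∸_) (degB-far j n≤j))))
          h0 exA (m≤n+m (h (∑ n wB)) (h (∑ n wA))) (test⇒hall {U n} {a n M} {b n M} {size n} (bdU n) tL)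
      , localise n (h (∑ n wA) + h (∑ n wB)) (flip-bounded bd) (λ j i → U⊑R n i j) (λ j i n≤i r → U-far {i} {j} r (≤-trans n≤i (pair-≥ˡ i j)))
          (λ j → m∸n≤m (wB j) (deg (flip (C n M)) j)) (λ i n≤i → ≤-reflexive (sym (cong (wA i ∸_) (degA-far i n≤i))))
          h0 exB (m≤m+n (h (∑ n wA)) (h (∑ n wB))) (test⇒hall {flip (U n)} {b n M} {a n M} {size n} (flip-bounded (bdU n)) tR))
      where
      U-far : ∀ {i j} → R i j ≡ true → n ≤ pair i j → U n i j ≡ true
      U-far r n≤π = cong₂ _∧_ r (≤ᵇ-true n≤π)
      C-far : ∀ {i j} → n ≤ pair i j → C n M i j ≡ false
      C-far {i} {j} n≤π rewrite ≤ᵇ-false {suc (pair i j)} {n} (s≤s n≤π) = ∧-zeroʳ (R i j)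
      degA-far : ∀ i → n ≤ i → deg (C n M) i ≡ 0
      degA-far i n≤i = ∑-zero (β (suc i)) (λ j _ → cong 𝟙 (C-far {i} {j} (≤-trans n≤i (pair-≥ˡ i j))))
      degB-far : ∀ j → n ≤ j → deg (flip (C n M)) j ≡ 0
      degB-far j n≤j = ∑-zero (β (suc j)) (λ i _ → cong 𝟙 (C-far {i} {j} (≤-trans n≤j (pair-≥ʳ i j))))

    -- decision n c m is the decision on the edge numbered m recorded in the
    -- state c reached after n decisions; the latest one is the lowest bit.
    decision : ℕ → ℕ → ℕ → Bool
    decision n c m = bit (n ∸ suc m) c

    decision-new : ∀ n c x → decision (suc n) (push c x) n ≡ x
    decision-new n c x rewrite n∸n≡0 n = bit-zero-push c x

    decision-old : ∀ {n m} c x → m < n → decision (suc n) (push c x) m ≡ decision n c m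
    decision-old {n} {m} c x m<n rewrite +-∸-assoc 1 m<n = bit-suc-push (n ∸ suc m) c x

    -- The edge is accepted tentatively, and the verdict of the test on this acceptance is the bit
    -- recorded. All earlier decisions sit in one number, so the run is a primitive recursion.
    state : ℕ → ℕ
    state = natrec 0 (λ n c → push c (test (suc n) (decision (suc n) (push c true))))

    state-good : ∀ n → Good n (decision n (state n))
    state-good zero = good (λ i → subst (_≤ wA i) (sym (deg0 i)) z≤n)
                           (λ j → subst (_≤ wB j) (sym (degᵀ0 j)) z≤n)
      ( hall-mono (bdU 0) R⊑U (λ i → m∸n≤m (wA i) (deg (C 0 (decision 0 0)) i)) (λ j → ≤-reflexive (sym (cong (wB j ∸_) (degᵀ0 j)))) (expanding-hall h0 exA)
      , hall-mono (flip-bounded (bdU 0)) (λ j i → R⊑U i j) (λ j → m∸n≤m (wB j) (deg (flip (C 0 (decision 0 0))) j)) (λ i → ≤-reflexive (sym (cong (wA i ∸_) (deg0 i)))) (expanding-hall h0 exB))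
      where
      R⊑U : R ⊑ U 0
      R⊑U i j r = cong (_∧ true) r
      deg0 : ∀ i → deg (C 0 (decision 0 0)) i ≡ 0
      deg0 i = ∑-zero (β (suc i)) (λ j _ → cong 𝟙 (∧-zeroʳ (R i j)))
      degᵀ0 : ∀ j → deg (flip (C 0 (decision 0 0))) j ≡ 0
      degᵀ0 j = ∑-zero (β (suc j)) (λ i _ → cong 𝟙 (∧-zeroʳ (R i j)))
    state-good (suc n) with test (suc n) (decision (suc n) (push (state n) true)) in eq
    ... | true  = test⇒good eq
    ... | false = good-reject
      (λ m m<n → decision-old (state n) false m<n) (decision-new n (state n) false)
      (λ m m<n → decision-old (state n) true m<n) (decision-new n (state n) true)
      (state-good n) (λ g → ∌-false (good⇒test g) eq)

    choice : ℕ → Bool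
    choice m = bit 0 (state (suc m))

    decision-choice : ∀ {n m} → m < n → decision n (state n) m ≡ choice m
    decision-choice {suc n} {m} m<n with m<1+n⇒m<n∨m≡n m<n
    ... | inj₁ m<n′ = trans (decision-old (state n) _ m<n′) (decision-choice m<n′)
    ... | inj₂ refl = cong (λ k → bit k (state (suc m))) (n∸n≡0 m)

    F : Graph
    F i j = R i j ∧ choice (pair i j)

    F⊑R : F ⊑ R
    F⊑R i j p = proj₁ (∧-elim p)

    C-final : ∀ {n i j} → pair i j < n → C n (decision n (state n)) i j ≡ F i j
    C-final π<n rewrite ≤ᵇ-true π<n | decision-choice π<n = refl

    U-final : ∀ {n i j} → (R i j ≡ true → pair i j < n) → U n i j ≡ false
    U-final π<n = ≢true λ p → case ∧-elim p of λ where
      (r , n≤π) → <⇒≱ (π<n r) (≤ᵇ-≤ n≤π)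

    degA : ∀ i → deg F i ≡ wA i
    degA i = ≤-antisym (subst (_≤ wA i) deg≡ (fitsA i))
                       (subst (wA i ≤_) deg≡ (m∸n≡0⇒m≤n (hall-isolated (proj₁ hall) i λ j →
                         U-final λ r → π<n (proj₂ (bounds bd r)))))
      where
      -- A stage beyond the numbers of all edges at `i`, whose other ends lie below `β (suc i)`.
      n = suc (∑ (β (suc i)) (λ j → pair i j))
      open Good (state-good n)
      π<n : ∀ {j} → j < β (suc i) → pair i j < n
      π<n j< = s≤s (term≤∑ (λ j → pair i j) j<)
      deg≡ : deg (C n (decision n (state n))) i ≡ deg F i
      deg≡ = ∑-cong (β (suc i)) (λ j j< → cong 𝟙 (C-final {n} {i} {j} (π<n j<)))

    degB : ∀ j → deg (flip F) j ≡ wB j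
    degB j = ≤-antisym (subst (_≤ wB j) deg≡ (fitsB j))
                       (subst (wB j ≤_) deg≡ (m∸n≡0⇒m≤n (hall-isolated (proj₂ hall) j λ i →
                         U-final λ r → π<n (proj₁ (bounds bd r)))))
      where
      n = suc (∑ (β (suc j)) (λ i → pair i j))
      open Good (state-good n)
      π<n : ∀ {i} → i < β (suc j) → pair i j < n
      π<n i< = s≤s (term≤∑ (λ i → pair i j) i<)
      deg≡ : deg (flip (C n (decision n (state n)))) j ≡ deg (flip F) j
      deg≡ = ∑-cong (β (suc j)) (λ i i< → cong 𝟙 (C-final {n} {i} {j} (π<n i<)))

    -- Codes for all ingredients of the run.

    module Algorithm (βᶜ : Comp₁ β) (Rᶜ : Comp₂ᵇ R) (wAᶜ : Comp₁ wA) (wBᶜ : Comp₁ wB) (hᶜ : Comp₁ h) where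

      call₁ : ∀ {n f x} → Comp 1 f → Comp n x → Comp n (λ xs → f (x xs ∷ []))
      call₁ c x = call c (x ∷ₐ []ₐ)

      layerᶜ : Comp₂ layer
      layerᶜ = natrecᶜ (var 0F) (call₁ βᶜ (call₁ βᶜ (var 1F))) (var 1F)

      sizeᶜ : Comp₁ size
      sizeᶜ = call layerᶜ (var 0F ∷ₐ
        call₁ hᶜ (∑ᶜ (var 0F) (call₁ wAᶜ (var 0F))) +ᶜ call₁ hᶜ (∑ᶜ (var 0F) (call₁ wBᶜ (var 0F))) ∷ₐ []ₐ)

      Uᶜ : Comp₃ᵇ U
      Uᶜ = callᵇ Rᶜ (var 1F ∷ₐ var 2F ∷ₐ []ₐ) ∧ᶜ (var 0F ≤ᶜ call pairᶜ (var 1F ∷ₐ var 2F ∷ₐ []ₐ))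

      Cᶜ : Comp₄ᵇ (λ n c i j → C n (decision n c) i j)
      Cᶜ = callᵇ Rᶜ (var 2F ∷ₐ var 3F ∷ₐ []ₐ) ∧ᶜ ((sucᶜ π ≤ᶜ var 0F) ∧ᶜ
           callᵇ bitᶜ (var 0F ∸ᶜ sucᶜ π ∷ₐ var 1F ∷ₐ []ₐ))
        where
        π = call pairᶜ (var {4} 2F ∷ₐ var 3F ∷ₐ []ₐ)

      degAᶜ : Comp₃ (λ n c i → deg (C n (decision n c)) i)
      degAᶜ = ∑ᶜ (call₁ βᶜ (sucᶜ (var 2F))) (value (callᵇ Cᶜ (var 1F ∷ₐ var 2F ∷ₐ var 3F ∷ₐ var 0F ∷ₐ []ₐ)))

      degBᶜ : Comp₃ (λ n c j → deg (flip (C n (decision n c))) j)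
      degBᶜ = ∑ᶜ (call₁ βᶜ (sucᶜ (var 2F))) (value (callᵇ Cᶜ (var 1F ∷ₐ var 2F ∷ₐ var 0F ∷ₐ var 3F ∷ₐ []ₐ)))

      aᶜ : Comp₃ (λ n c i → a n (decision n c) i)
      aᶜ = call₁ wAᶜ (var 2F) ∸ᶜ degAᶜ

      bᶜ : Comp₃ (λ n c j → b n (decision n c) j)
      bᶜ = call₁ wBᶜ (var 2F) ∸ᶜ degBᶜ

      subsetᶜ : Comp₃ᵇ subset
      subsetᶜ = callᵇ bitᶜ (var 2F ∷ₐ var 1F ∷ₐ []ₐ) ∧ᶜ (sucᶜ (var 2F) ≤ᶜ var 0F)

      hallTestᶜ : ∀ S x y → Comp₃ᵇ S → Comp₃ x → Comp₃ y → Comp₃ᵇ (λ n c L → hallTest (S n) (x n c) (y n c) L)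
      hallTestᶜ _ _ _ S x y = all<ᶜ (2^ᶜ (var 2F))
        -- Binders are added in front: in the summands the variables are the summation index, the
        -- code of the subset, then `n`, `c`, `L`. The inner search over neighbours adds one more.
        (∑ᶜ (var 3F) (value (callᵇ subsetᶜ (var 4F ∷ₐ var 1F ∷ₐ var 0F ∷ₐ []ₐ))
                      *ᶜ call x (var 2F ∷ₐ var 3F ∷ₐ var 0F ∷ₐ []ₐ))
         ≤ᶜ
         ∑ᶜ (call₁ βᶜ (var 3F))
           (value (any<ᶜ (call₁ βᶜ (sucᶜ (var 0F)))
                    (callᵇ subsetᶜ (var 5F ∷ₐ var 2F ∷ₐ var 0F ∷ₐ []ₐ) ∧ᶜ
                     callᵇ S (var 3F ∷ₐ var 0F ∷ₐ var 1F ∷ₐ []ₐ)))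
            *ᶜ call y (var 2F ∷ₐ var 3F ∷ₐ var 0F ∷ₐ []ₐ)))

      testᶜ : Comp₂ᵇ (λ n c → test n (decision n c))
      testᶜ =
        (all<ᶜ (var 0F) (call degAᶜ (var 1F ∷ₐ var 2F ∷ₐ var 0F ∷ₐ []ₐ) ≤ᶜ call₁ wAᶜ (var 0F)) ∧ᶜ
         all<ᶜ (var 0F) (call degBᶜ (var 1F ∷ₐ var 2F ∷ₐ var 0F ∷ₐ []ₐ) ≤ᶜ call₁ wBᶜ (var 0F))) ∧ᶜ
        (callᵇ (hallTestᶜ U a′ b′ Uᶜ aᶜ bᶜ) (var 0F ∷ₐ var 1F ∷ₐ call₁ sizeᶜ (var 0F) ∷ₐ []ₐ) ∧ᶜ
         callᵇ (hallTestᶜ (flip ∘ U) b′ a′ Uᵀᶜ bᶜ aᶜ) (var 0F ∷ₐ var 1F ∷ₐ call₁ sizeᶜ (var 0F) ∷ₐ []ₐ))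
        where
        a′ b′ : ℕ → ℕ → ℕ → ℕ
        a′ n c = a n (decision n c)
        b′ n c = b n (decision n c)
        Uᵀᶜ : Comp₃ᵇ (λ n i j → U n j i)
        Uᵀᶜ = callᵇ Uᶜ (var 0F ∷ₐ var 2F ∷ₐ var 1F ∷ₐ []ₐ)

      stateᶜ : Comp₁ state
      stateᶜ = natrecᶜ (lit 0)
        (var 1F +ᶜ var 1F +ᶜ value (callᵇ testᶜ (sucᶜ (var 0F) ∷ₐ var 1F +ᶜ var 1F +ᶜ lit 1 ∷ₐ []ₐ)))
        (var 0F)

      Fᶜ : Comp₂ᵇ F
      Fᶜ = Rᶜ ∧ᶜ callᵇ bitᶜ (lit 0 ∷ₐ call₁ stateᶜ (sucᶜ pairᶜ) ∷ₐ []ₐ)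

-- Cardinalities of finite sets

elems : ℕ → (ℕ → Bool) → List ℕ
elems m X = filter (λ i → true? (X i)) (downFrom m)

count : ℕ → (ℕ → Bool) → ℕ
count m X = ∑ m (λ i → 𝟙 (X i))

∈-elems⁺ : ∀ {m X i} → i < m → X ∋ i → i ∈ elems m X
∈-elems⁺ {X = X} i<m x = ∈-filter⁺ (λ i → true? (X i)) (∈-downFrom⁺ i<m) x

∈-elems⁻ : ∀ {m X i} → i ∈ elems m X → i < m × X ∋ i
∈-elems⁻ {m} {X} p with ∈-filter⁻ (λ i → true? (X i)) {xs = downFrom m} p
... | i∈ , x = ∈-downFrom⁻ i∈ , x

elems-unique : ∀ m X → Unique (elems m X)
elems-unique m X = Unique.filter⁺ (λ i → true? (X i)) (Unique.downFrom⁺ m)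

length-elems : ∀ m X → length (elems m X) ≡ count m X
length-elems zero    X = refl
length-elems (suc m) X with X m
... | true  = trans (cong suc (length-elems m X)) (+-comm 1 _)
... | false = trans (length-elems m X) (sym (+-identityʳ _))

unique-length-≤ : ∀ {A : Set} {xs ys : List A} → Unique xs → (∀ {x} → x ∈ xs → x ∈ ys) →
                  length xs ≤ length ys
unique-length-≤ {xs = []}     _          _   = z≤n
unique-length-≤ {xs = x ∷ xs} (x∉ ∷ uxs) sub with ∈-∃++ (sub (here refl))
... | ys , zs , refl = begin
  suc (length xs)                  ≤⟨ s≤s (unique-length-≤ uxs sub′) ⟩
  suc (length (ys ++ zs))          ≡⟨ cong suc (length-++ ys) ⟩
  suc (length ys + length zs)      ≡⟨ +-suc (length ys) (length zs) ⟨
  length ys + length (x ∷ zs)      ≡⟨ length-++ ys ⟨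
  length (ys ++ x ∷ zs)            ∎
  where
  open ≤-Reasoning
  sub′ : ∀ {y} → y ∈ xs → y ∈ ys ++ zs
  sub′ y∈ with ∈-++⁻ ys (sub (there y∈))
  ... | inj₁ y∈ys             = ∈-++⁺ˡ y∈ys
  ... | inj₂ (here refl)      = ⊥-elim (All.lookup x∉ y∈ refl)
  ... | inj₂ (there y∈zs)     = ∈-++⁺ʳ ys y∈zs

upper-bound : ∀ {A : Set} (f : A → ℕ) xs → ∃[ m ] (∀ {x} → x ∈ xs → f x < m)
upper-bound f []       = 0 , λ ()
upper-bound f (x ∷ xs) with upper-bound f xs
... | m , below = suc (f x) ⊔ m , λ where
  (here refl) → m≤m⊔n (suc (f x)) m
  (there x∈)  → <-≤-trans (below x∈) (m≤n⊔m (suc (f x)) m)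

least-root : ∀ (g : ℕ → ℕ) m → g m ≡ 0 → ∃[ l ] g l ≡ 0 × (∀ z → z < l → g z ≢ 0)
least-root g m gm≡0 with g 0 ≟ 0
least-root g m       gm≡0 | yes g0≡0 = 0 , g0≡0 , λ _ ()
least-root g zero    gm≡0 | no g0≢0 = ⊥-elim (g0≢0 gm≡0)
least-root g (suc m) gm≡0 | no g0≢0 with least-root (g ∘ suc) m gm≡0
... | l , root , least = suc l , root , λ where
  zero    _         → g0≢0
  (suc z) (s≤s z<l) → least z z<l

-- Integer and rational surpluses as inequalities of natural numbers.

ℤ-surplus : ∀ {n q k p} → pos n ℤ.≤ pos q ℤ.- pos k ℤ.* pos p → k * p + n ≤ q
ℤ-surplus {n} {q} {k} {p} le = ℤ.drop‿+≤+ (begin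
  pos (k * p + n)                                           ≡⟨ ℤ.pos-+ (k * p) n ⟩
  pos (k * p) ℤ.+ pos n                                     ≤⟨ ℤ.+-monoʳ-≤ (pos (k * p)) le ⟩
  pos (k * p) ℤ.+ (pos q ℤ.- pos k ℤ.* pos p)               ≡⟨ cong (λ z → pos (k * p) ℤ.+ (pos q ℤ.- z)) (ℤ.pos-* k p) ⟨
  pos (k * p) ℤ.+ (pos q ℤ.- pos (k * p))                   ≡⟨ cancel (pos (k * p)) (pos q) ⟩
  pos q                                                     ∎)
  where
  open ℤ.≤-Reasoning
  cancel : ∀ x y → x ℤ.+ (y ℤ.- x) ≡ y
  cancel = solveℤ-∀

-- Multiplication by the denominator `k` yields the surplus `n * k`, of which only `n` is kept, to
-- match the form of `Expanding`.
ℚ-surplus : ∀ {n q p} k .{{_ : NonZero k}} → pos n / 1 ℚ.≤ pos q / 1 ℚ.- (pos 1 / k) ℚ.* (pos p / 1) →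
            p + n ≤ q * k
ℚ-surplus zero le = ⊥-elim (≢-nonZero⁻¹ 0 refl)
ℚ-surplus {n} {q} {p} (suc k) le = ≤-trans (+-monoʳ-≤ p (m≤m*n n (suc k))) (ℤ.drop‿+≤+ (begin
  pos (p + n * suc k)                                       ≡⟨ trans (ℤ.pos-+ p _) (cong (ℤ._+_ (pos p)) (ℤ.pos-* n (suc k))) ⟩
  pos p ℤ.+ pos n ℤ.* K                                     ≡⟨ lhs (pos p) (pos n) K ⟨
  pos p ℤ.+ pos n ℤ.* (pos 1 ℤ.* (K ℤ.* pos 1))             ≤⟨ ℤ.+-monoʳ-≤ (pos p) leℤ ⟩
  pos p ℤ.+ (pos q ℤ.* (K ℤ.* pos 1) ℤ.+ (ℤ.- (pos 1 ℤ.* pos p)) ℤ.* pos 1) ℤ.* pos 1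
                                                            ≡⟨ rhs (pos p) (pos q) K ⟩
  pos q ℤ.* K                                               ≡⟨ ℤ.pos-* q (suc k) ⟨
  pos (q * suc k)                                           ∎))
  where
  open ℤ.≤-Reasoning
  K = pos (suc k)
  lhs : ∀ p n k → p ℤ.+ n ℤ.* (pos 1 ℤ.* (k ℤ.* pos 1)) ≡ p ℤ.+ n ℤ.* k
  lhs = solveℤ-∀
  rhs : ∀ p q k → p ℤ.+ (q ℤ.* (k ℤ.* pos 1) ℤ.+ (ℤ.- (pos 1 ℤ.* p)) ℤ.* pos 1) ℤ.* pos 1 ≡ q ℤ.* k
  rhs = solveℤ-∀
  -- `_/_` reduces fractions. Among unnormalised rationals the inequality is the cross-multiplied
  -- one of integers, with known denominators.
  leᵘ : mkℚᵘ (pos n) 0 ℚᵘ.≤ mkℚᵘ (pos q) 0 ℚᵘ.- mkℚᵘ (pos 1) k ℚᵘ.* mkℚᵘ (pos p) 0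
  leᵘ = ℚᵘ.≤-respˡ-≃ (ℚ.toℚᵘ-fromℚᵘ (mkℚᵘ (pos n) 0)) (ℚᵘ.≤-respʳ-≃ (ℚᵘ.≃-trans
          (ℚ.toℚᵘ-homo-+ (pos q / 1) (ℚ.- ((pos 1 / suc k) ℚ.* (pos p / 1))))
          (ℚᵘ.+-cong (ℚ.toℚᵘ-fromℚᵘ (mkℚᵘ (pos q) 0)) (ℚᵘ.≃-trans
            (ℚ.toℚᵘ-homo‿- ((pos 1 / suc k) ℚ.* (pos p / 1))) (ℚᵘ.-‿cong (ℚᵘ.≃-trans
              (ℚ.toℚᵘ-homo-* (pos 1 / suc k) (pos p / 1))
              (ℚᵘ.*-cong (ℚ.toℚᵘ-fromℚᵘ (mkℚᵘ (pos 1) k)) (ℚ.toℚᵘ-fromℚᵘ (mkℚᵘ (pos p) 0))))))))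
          (ℚ.toℚᵘ-mono-≤ le))
  leℤ : pos n ℤ.* (pos 1 ℤ.* (K ℤ.* pos 1)) ℤ.≤ (pos q ℤ.* (K ℤ.* pos 1) ℤ.+ (ℤ.- (pos 1 ℤ.* pos p)) ℤ.* pos 1) ℤ.* pos 1
  leℤ = ℚᵘ.drop-*≤* leᵘ

-- Transfer to the given graph

∧-intro : ∀ {x y} → x ≡ true → y ≡ true → x ∧ y ≡ true
∧-intro refl refl = refl

positive : ℕ → Bool
positive c = 1 ≤ᵇ c

charValue-sound : ∀ {P c} → CharValue P c → positive c ≡ true → P
charValue-sound (inj₁ (p , _))    _ = p
charValue-sound (inj₂ (_ , refl)) ()

charValue-complete : ∀ {P c} → CharValue P c → P → positive c ≡ true
charValue-complete (inj₁ (_ , refl)) _ = refl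
charValue-complete (inj₂ (¬p , _))   p = ⊥-elim (¬p p)

𝟙-charValue : ∀ {P x} → (x ≡ true → P) → (P → x ≡ true) → CharValue P (𝟙 x)
𝟙-charValue {x = true}  sound complete = inj₁ (sound refl , refl)
𝟙-charValue {x = false} sound complete = inj₂ ((λ p → case complete p of λ ()) , refl)

hasCard-⇔ : ∀ {T : Set} {P Q : Pred T 0ℓ} {n} → (∀ x → P x → Q x) → (∀ x → Q x → P x) → HasCard P n → HasCard Q n
hasCard-⇔ P⇒Q Q⇒P (xs , unique , iff , len) =
  xs , unique , (λ x → mk⇔ (P⇒Q x ∘ Equivalence.to (iff x)) (Equivalence.from (iff x) ∘ Q⇒P x)) , len

-- The given graph in terms of vertex numbers, with a computable bound on neighbours.

module Instance (k : ℕ) .{{_ : NonZero k}} (Γ : BipartiteGraph)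
  (ν : ℕ ⤖ BipartiteGraph.V Γ) (highly : BipartiteGraph.HighlyComputable Γ ν)
  (bip : BipartiteGraph.ComputablyBipartite Γ ν) (cehhc : BipartiteGraph.CEHHC Γ k) where

  open BipartiteGraph Γ hiding (N)
  open Bijection ν using (to; injective; surjective)
  open CEHHC cehhc using (h; h-computable; h0; expandA; expandB)

  χ : ℕ → ℕ → ℕ
  χ = proj₁ (proj₁ (proj₂ highly))

  χᶜ : Comp₂ χ
  χᶜ = from-fun₂ (proj₁ (proj₂ (proj₁ (proj₂ highly))))

  χ-char : ∀ i j → CharValue (onV E (to i) (to j)) (χ i j)
  χ-char = proj₂ (proj₂ (proj₁ (proj₂ highly)))

  d : ℕ → ℕ
  d = proj₁ (proj₂ (proj₂ highly))

  dᶜ : Comp₁ d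
  dᶜ = from-fun (proj₁ (proj₂ (proj₂ (proj₂ highly))))

  d-card : ∀ i → HasCard (BipartiteGraph.N Γ (to i)) (d i)
  d-card = proj₂ (proj₂ (proj₂ (proj₂ highly)))

  χA : ℕ → ℕ
  χA = proj₁ (proj₂ bip)

  χAᶜ : Comp₁ χA
  χAᶜ = from-fun (proj₁ (proj₂ (proj₂ bip)))

  χA-char : ∀ i → CharValue (InA (to i)) (χA i)
  χA-char = proj₂ (proj₂ (proj₂ bip))

  from : V → ℕ
  from v = proj₁ (surjective v)

  to-from : ∀ v → to (from v) ≡ v
  to-from v = proj₂ (surjective v) refl

  from-to : ∀ i → from (to i) ≡ i
  from-to i = injective (to-from (to i))

  isA : ℕ → Bool
  isA i = positive (χA i)

  isA-sound : ∀ {i} → isA i ≡ true → InA (to i)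
  isA-sound = charValue-sound (χA-char _)

  isA-complete : ∀ {i} → InA (to i) → isA i ≡ true
  isA-complete = charValue-complete (χA-char _)

  notA-sound : ∀ {i} → isA i ≡ false → InB (to i)
  notA-sound {i} p with to i in eq
  ... | inj₂ b = b , refl
  ... | inj₁ a = ⊥-elim (∌-false (isA-complete (a , eq)) p)

  isA-inj₁ : ∀ {i a} → to i ≡ inj₁ a → isA i ≡ true
  isA-inj₁ eq = isA-complete (_ , eq)

  isA-inj₂ : ∀ {i b} → to i ≡ inj₂ b → isA i ≡ false
  isA-inj₂ eq = ≢true λ p → case trans (sym eq) (proj₂ (isA-sound p)) of λ ()

  R : Graph
  R i j = positive (χ i j)

  R-sound : ∀ {i j} → R i j ≡ true → onV E (to i) (to j)
  R-sound = charValue-sound (χ-char _ _)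

  R-complete : ∀ {i j} → onV E (to i) (to j) → R i j ≡ true
  R-complete = charValue-complete (χ-char _ _)

  onV-ends : ∀ {Q : REL A B 0ℓ} {x y} → onV Q x y → InA x × InB y
  onV-ends {x = inj₁ a} {inj₂ b} _ = (a , refl) , (b , refl)

  R-left : ∀ {i j} → R i j ≡ true → isA i ≡ true
  R-left {i} {j} r = isA-complete (proj₁ (onV-ends {E} {to i} {to j} (R-sound r)))

  R-right : ∀ {i j} → R i j ≡ true → isA j ≡ false
  R-right {i} {j} r = isA-inj₂ (proj₂ (proj₂ (onV-ends {E} {to i} {to j} (R-sound r))))

  adjacent : ℕ → ℕ → Bool
  adjacent i j = positive (χ i j + χ j i)

  adjacent-complete : ∀ {i j} → Adjacent (to i) (to j) → adjacent i j ≡ true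
  adjacent-complete {i} {j} (inj₁ e) = ≤ᵇ-true (≤-trans (≤ᵇ-≤ {1} (R-complete e)) (m≤m+n (χ i j) (χ j i)))
  adjacent-complete {i} {j} (inj₂ e) = ≤ᵇ-true (≤-trans (≤ᵇ-≤ {1} (R-complete e)) (m≤n+m (χ j i) (χ i j)))

  adjacent-sound : ∀ {i j} → adjacent i j ≡ true → Adjacent (to i) (to j)
  adjacent-sound {i} {j} p with true? (R i j)
  ... | yes r = inj₁ (R-sound r)
  ... | no ¬r = inj₂ (R-sound (subst (λ c → positive (c + χ j i) ≡ true) (zero-of (χ i j) ¬r) p))
    where
    zero-of : ∀ c → positive c ≢ true → c ≡ 0
    zero-of zero    _  = refl
    zero-of (suc c) ¬p = ⊥-elim (¬p refl)

  missing : ℕ → ℕ → ℕ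
  missing i m = d i ∸ count m (adjacent i)

  missing-root : ∀ i → ∃[ m ] missing i m ≡ 0
  missing-root i with d-card i
  ... | xs , unique , iff , len with upper-bound from xs
  ...   | m , below = m , m≤n⇒m∸n≡0 (begin
      d i                                  ≡⟨ len ⟨
      length xs                            ≤⟨ unique-length-≤ unique sub ⟩
      length (map to (elems m (adjacent i))) ≡⟨ length-map to (elems m (adjacent i)) ⟩
      length (elems m (adjacent i))        ≡⟨ length-elems m (adjacent i) ⟩
      count m (adjacent i)                 ∎)
    where
    open ≤-Reasoning
    sub : ∀ {x} → x ∈ xs → x ∈ map to (elems m (adjacent i))
    sub {x} x∈ = subst (_∈ _) (to-from x) (∈-map⁺ to (∈-elems⁺ (below x∈)
      (adjacent-complete (subst (Adjacent (to i)) (sym (to-from x)) (Equivalence.to (iff x) x∈)))))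

  abstract
    least-missing : ∀ i → ∃[ l ] missing i l ≡ 0 × (∀ z → z < l → missing i z ≢ 0)
    least-missing i = least-root (missing i) (proj₁ (missing-root i)) (proj₂ (missing-root i))

  -- High computability enters here: the number of neighbours is known, so a search can stop as soon
  -- as that many have been found.
  nbrBound : ℕ → ℕ
  nbrBound i = proj₁ (least-missing i)

  -- A neighbour outside the range would, together with those counted below `l`, make more than `n`
  -- distinct neighbours.
  none-missing : ∀ {n i j l} → HasCard (BipartiteGraph.N Γ (to i)) n → n ≤ count l (adjacent i) →
                 adjacent i j ≡ true → j < l
  none-missing {n} {i} {j} {l} (xs , unique , iff , len) n≤ adj =
    decidable-stable (j <? l) λ j≮l → <⇒≱ (too-many j≮l) n≤
    where
    open ≤-Reasoning
    known = elems l (adjacent i)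
    sub : ∀ {x} → x ∈ map to (j ∷ known) → x ∈ xs
    sub x∈ with ∈-map⁻ to x∈
    ... | _ , here refl , refl = Equivalence.from (iff _) (adjacent-sound {i} {j} adj)
    ... | y , there y∈  , refl = Equivalence.from (iff _) (adjacent-sound {i} {y} (proj₂ (∈-elems⁻ {l} {adjacent i} y∈)))
    fresh : ¬ (j < l) → All (j ≢_) known
    fresh j≮l = All.tabulate λ y∈ j≡y → j≮l (subst (_< l) (sym j≡y) (proj₁ (∈-elems⁻ {l} {adjacent i} y∈)))
    too-many : ¬ (j < l) → count l (adjacent i) < n
    too-many j≮l = begin
      suc (count l (adjacent i))           ≡⟨ cong suc (length-elems l (adjacent i)) ⟨
      length (j ∷ known)                   ≡⟨ length-map to (j ∷ known) ⟨
      length (map to (j ∷ known))          ≤⟨ unique-length-≤ (Unique.map⁺ injective (fresh j≮l ∷ elems-unique l (adjacent i))) sub ⟩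
      length xs                            ≡⟨ len ⟩
      n                                    ∎

  nbrBound-bounds : ∀ {i j} → adjacent i j ≡ true → j < nbrBound i
  nbrBound-bounds {i} {j} = none-missing {d i} {i} {j} {nbrBound i} (d-card i)
    (m∸n≡0⇒m≤n {d i} {count (nbrBound i) (adjacent i)} (proj₁ (proj₂ (least-missing i))))

  nbrBoundᶜ : Comp₁ nbrBound
  nbrBoundᶜ = minimise (λ xs → nbrBound (lookup xs 0F)) missingᶜ
    (λ xs → proj₁ (proj₂ (least-missing (lookup xs 0F))))
    (λ xs → proj₂ (proj₂ (least-missing (lookup xs 0F))))
    where
    missingᶜ : Comp₂ (λ m i → missing i m)
    missingᶜ = call dᶜ (var 1F ∷ₐ []ₐ) ∸ᶜ ∑ᶜ (var 0F) (Compᵇ.value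
      (lit 1 ≤ᶜ (call χᶜ (var 2F ∷ₐ var 0F ∷ₐ []ₐ) +ᶜ call χᶜ (var 0F ∷ₐ var 2F ∷ₐ []ₐ))))

  -- The summand `m` makes `β` inflationary; a sum in place of a maximum makes it monotone and still
  -- dominates each single bound.
  β : ℕ → ℕ
  β m = m + ∑ m nbrBound

  β-mono : ∀ {m n} → m ≤ n → β m ≤ β n
  β-mono m≤n = +-mono-≤ m≤n (∑-≤ nbrBound m≤n)

  β-infl : ∀ m → m ≤ β m
  β-infl m = m≤m+n m _

  open Core β β-mono β-infl

  R-bounded : Bounded R
  R-bounded = bounded λ {i} {j} r →
    below (nbrBound-bounds {j} {i} (adjacent-complete {j} {i} (inj₂ (R-sound r)))) ,
    below (nbrBound-bounds {i} {j} (adjacent-complete {i} {j} (inj₁ (R-sound r))))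
    where
    below : ∀ {i j} → j < nbrBound i → j < β (suc i)
    below {i} j< = <-≤-trans j< (≤-trans (term≤∑ {suc i} nbrBound ≤-refl) (m≤n+m _ (suc i)))

  -- Finite vertex sets, and the expansion of the numbered graph.

  image : (ℕ → Bool) → Pred V 0ℓ
  image X v = ∃[ i ] X ∋ i × to i ≡ v

  image-card : ∀ {m X} → X ⊂< m → HasCard (image X) (count m X)
  image-card {m} {X} X< = map to (elems m X) , Unique.map⁺ injective (elems-unique m X) ,
    (λ v → mk⇔ (λ v∈ → case ∈-map⁻ to v∈ of λ where
                   (i , i∈ , refl) → i , proj₂ (∈-elems⁻ {m} {X} i∈) , refl)
               (λ { (i , x , refl) → ∈-map⁺ to (∈-elems⁺ (X< i x) x) })) ,
    trans (length-map to (elems m X)) (length-elems m X)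

  neighbours-card : ∀ {S m X} → Bounded S → X ⊂< m →
    (∀ {i j} → X ∋ i → S i j ≡ true → Adjacent (to i) (to j)) →
    (∀ {i j} → X ∋ i → Adjacent (to i) (to j) → S i j ≡ true) →
    HasCard N[ image X ] (count (β m) (N S X))
  neighbours-card {S} {m} {X} bd X< sound complete = hasCard-⇔ forth back (image-card (N-⊂< X bd X<))
    where
    forth : ∀ v → image (N S X) v → N[ image X ] v
    forth v (j , p , refl) with N-elim S X p
    ... | i , x , s = to i , (i , x , refl) , sound x s
    back : ∀ v → N[ image X ] v → image (N S X) v
    back v (_ , (i , x , refl) , adj) =
      from v , N-intro X bd x (complete x (subst (Adjacent (to i)) (sym (to-from v)) adj)) , to-from v

  -- Each side of the numbered graph is a copy of all of ℕ. Numbers of vertices on the wrong side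
  -- are padding: they have weight 0 and no edges.
  wA wB : ℕ → ℕ
  wA i = 𝟙 (isA i) * k
  wB j = 𝟙 (not (isA j))

  wB≤1 : ∀ j → wB j ≤ 1
  wB≤1 j with isA j
  ... | true  = z≤n
  ... | false = ≤-refl

  onA onB : (ℕ → Bool) → ℕ → Bool
  onA X i = X i ∧ isA i
  onB X i = X i ∧ not (isA i)

  W-wA : ∀ m X → W m wA X ≡ count m (onA X) * k
  W-wA m X = trans (∑-cong m (λ i _ → pointwise i)) (∑-*ʳ m _ k)
    where
    pointwise : ∀ i → 𝟙 (X i) * (𝟙 (isA i) * k) ≡ 𝟙 (X i ∧ isA i) * k
    pointwise i with X i
    ... | true  = +-identityʳ _
    ... | false = refl

  W-wB : ∀ m X → W m wB X ≡ count m (onB X)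
  W-wB m X = ∑-cong m (λ i _ → pointwise i)
    where
    pointwise : ∀ i → 𝟙 (X i) * 𝟙 (not (isA i)) ≡ 𝟙 (X i ∧ not (isA i))
    pointwise i with X i
    ... | true  = +-identityʳ _
    ... | false = refl

  count-⊆ : ∀ m {X Y} → X ⊆ Y → count m X ≤ count m Y
  count-⊆ m {X} {Y} X⊆Y = ∑-mono m λ i _ →
    subst₂ _≤_ (*-identityʳ _) (*-identityʳ _) (𝟙≤ (X i) (Y i) 1 (X⊆Y i))

  -- `Expanding` measures sets by weight. A set in A weighs `k` times its cardinality, which scales
  -- the threshold by `k`; for sets in B the larger threshold still suffices, as `k` is at least 1.
  h′ : ℕ → ℕ
  h′ n = k * h n

  -- All weight of `X` sits on its part in A, so the harem condition is applied to that part; its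
  -- neighbours under `R` are exactly its neighbours in the given graph and lie in B.
  expanding-A : Expanding R wA wB h′
  expanding-A m X n X< large = begin
    W m wA X + n                        ≡⟨ cong (_+ n) (trans (W-wA m X) (*-comm (count m (onA X)) k)) ⟩
    k * count m (onA X) + n             ≤⟨ ℤ-surplus {n} {count (β m) (N R (onA X))} {k} {count m (onA X)} (expandA (image (onA X)) left _ _ (image-card onA<)
                                             (neighbours-card R-bounded onA< (λ _ → inj₁ ∘ R-sound) complete) n
                                             (*-cancelˡ-≤ k (subst (h′ n ≤_) (trans (W-wA m X) (*-comm (count m (onA X)) k)) large))) ⟩
    count (β m) (N R (onA X))           ≤⟨ count-⊆ (β m) sub ⟩
    count (β m) (onB (N R X))           ≡⟨ W-wB (β m) (N R X) ⟨
    W (β m) wB (N R X)                  ∎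
    where
    open ≤-Reasoning
    onA< : onA X ⊂< m
    onA< i p = X< i (proj₁ (∧-elim p))
    left : ∀ {v} → image (onA X) v → InA v
    left (i , p , refl) = isA-sound (proj₂ (∧-elim p))
    complete : ∀ {i j} → onA X ∋ i → Adjacent (to i) (to j) → R i j ≡ true
    complete         p (inj₁ e) = R-complete e
    complete {i} {j} p (inj₂ e) = ⊥-elim (∌-false (proj₂ (∧-elim {X i} p)) (R-right {j} {i} (R-complete e)))
    sub : N R (onA X) ⊆ onB (N R X)
    sub j p with N-elim R (onA X) p
    ... | i , x , r = ∧-intro (N-intro X R-bounded (proj₁ (∧-elim x)) r) (cong not (R-right {i} {j} r))

  expanding-B : Expanding (flip R) wB wA h′
  expanding-B m Y n Y< large = begin
    W m wB Y + n                             ≡⟨ cong (_+ n) (W-wB m Y) ⟩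
    count m (onB Y) + n                      ≤⟨ ℚ-surplus {n} {count (β m) (N (flip R) (onB Y))} {count m (onB Y)} k (expandB (image (onB Y)) right _ _ (image-card onB<)
                                                  (neighbours-card (flip-bounded R-bounded) onB< (λ _ → inj₂ ∘ R-sound) complete) n
                                                  (≤-trans (m≤n*m (h n) k) (subst (h′ n ≤_) (W-wB m Y) large))) ⟩
    count (β m) (N (flip R) (onB Y)) * k     ≤⟨ *-monoˡ-≤ k (count-⊆ (β m) sub) ⟩
    count (β m) (onA (N (flip R) Y)) * k     ≡⟨ W-wA (β m) (N (flip R) Y) ⟨
    W (β m) wA (N (flip R) Y)                ∎
    where
    open ≤-Reasoning
    onB< : onB Y ⊂< m
    onB< j p = Y< j (proj₁ (∧-elim p))
    right : ∀ {v} → image (onB Y) v → InB v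
    right (j , p , refl) = notA-sound (not-true (proj₂ (∧-elim {Y j} p)))
    complete : ∀ {j i} → onB Y ∋ j → Adjacent (to j) (to i) → R i j ≡ true
    complete         p (inj₂ e) = R-complete e
    complete {j} {i} p (inj₁ e) = ⊥-elim (∌-false (R-left {j} {i} (R-complete e)) (not-true (proj₂ (∧-elim {Y j} p))))
    sub : N (flip R) (onB Y) ⊆ onA (N (flip R) Y)
    sub i p with N-elim (flip R) (onB Y) p
    ... | j , y , r = ∧-intro (N-intro Y (flip-bounded R-bounded) (proj₁ (∧-elim y)) r) (R-left {i} {j} r)

  h′0 : h′ 0 ≡ 0
  h′0 = trans (cong (k *_) h0) (*-zeroʳ k)

  isAᶜ : Compᵇ 1 (λ xs → isA (lookup xs 0F))
  isAᶜ = lit 1 ≤ᶜ χAᶜ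

  -- From the solution on numbers to a perfect matching.

  module FromSolution (F : Graph) (F⊑R : F ⊑ R) (degA : ∀ (i : ℕ) → deg F i ≡ wA i)
    (degB : ∀ (j : ℕ) → deg (flip F) j ≡ wB j) (Fᶜ : Comp₂ᵇ F) where

    M : REL A B 0ℓ
    M a b = F (from (inj₁ a)) (from (inj₂ b)) ≡ true

    F-card : ∀ i → length (elems (β (suc i)) (F i)) ≡ wA i
    F-card i = trans (length-elems (β (suc i)) (F i)) (degA i)

    Fᵀ-card : ∀ j → length (elems (β (suc j)) (flip F j)) ≡ wB j
    Fᵀ-card j = trans (length-elems (β (suc j)) (flip F j)) (degB j)

    F-right : ∀ {i j} → F i j ≡ true → InB (to j)
    F-right {i} {j} f = proj₂ (onV-ends {E} {to i} {to j} (R-sound (F⊑R _ _ f)))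

    F-left : ∀ {i j} → F i j ≡ true → InA (to i)
    F-left {i} {j} f = proj₁ (onV-ends {E} {to i} {to j} (R-sound (F⊑R _ _ f)))

    -- The neighbours found through `to` are elements of `V`, whereas the cardinality of `M a` is
    -- witnessed by a list of elements of `B`.
    strip : ∀ (vs : List V) → (∀ {v} → v ∈ vs → InB v) → ∃[ bs ] map inj₂ bs ≡ vs
    strip []       _   = [] , refl
    strip (v ∷ vs) inB with inB (here refl) | strip vs (inB ∘ there)
    ... | b , refl | bs , refl = b ∷ bs , refl

    M⊆E : M ⇒ E
    M⊆E {a} {b} p = subst₂ (onV E) (to-from (inj₁ a)) (to-from (inj₂ b)) (R-sound (F⊑R _ _ p))

    exactly : ∀ a → HasCard (M a) k
    exactly a with strip (map to js) inB
      where
      i = from (inj₁ a)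
      js = elems (β (suc i)) (F i)
      inB : ∀ {v} → v ∈ map to js → InB v
      inB v∈ with ∈-map⁻ to v∈
      ... | j , j∈ , refl = F-right {i} {j} (proj₂ (∈-elems⁻ {β (suc i)} {F i} j∈))
    ... | bs , eq = bs , Unique.map⁻ (subst Unique (sym eq) (Unique.map⁺ injective (elems-unique (β (suc i)) (F i))))
                  , (λ b → mk⇔ (sound b) (complete b))
                  , (begin
        length bs                   ≡⟨ length-map inj₂ bs ⟨
        length (map inj₂ bs)        ≡⟨ cong length eq ⟩
        length (map to js)          ≡⟨ length-map to js ⟩
        length js                   ≡⟨ F-card i ⟩
        𝟙 (isA i) * k               ≡⟨ cong (λ x → 𝟙 x * k) (isA-inj₁ (to-from (inj₁ a))) ⟩
        1 * k                       ≡⟨ *-identityˡ k ⟩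
        k                           ∎)
      where
      open ≡-Reasoning
      i = from (inj₁ a)
      js = elems (β (suc i)) (F i)
      sound : ∀ b → b ∈ bs → M a b
      sound b b∈ with ∈-map⁻ to (subst (inj₂ b ∈_) eq (∈-map⁺ inj₂ b∈))
      ... | j , j∈ , b≡ = subst (λ j → F i j ≡ true) (trans (sym (from-to j)) (cong from (sym b≡)))
                            (proj₂ (∈-elems⁻ {β (suc i)} {F i} j∈))
      complete : ∀ b → M a b → b ∈ bs
      complete b m with ∈-map⁻ inj₂ (subst (inj₂ b ∈_) (sym eq) (subst (_∈ map to js) (to-from (inj₂ b))
                          (∈-map⁺ to (∈-elems⁺ {β (suc i)} {F i} (proj₂ (Bounded.bounds R-bounded (F⊑R _ _ m))) m))))
      ... | _ , b∈ , refl = b∈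

    unique : ∀ b → ∃! _≡_ (λ a → M a b)
    -- For a vertex of B the prescribed degree reduces to 1, so only the one-element list remains as
    -- a case.
    unique b with elems (β (suc j)) (flip F j) in eq
                | trans (Fᵀ-card j) (cong (λ x → 𝟙 (not x)) (isA-inj₂ (to-from (inj₂ b))))
      where j = from (inj₂ b)
    ... | i ∷ [] | _ = a , m , only
      where
      j = from (inj₂ b)
      f : F i j ≡ true
      f = proj₂ (∈-elems⁻ {β (suc j)} {flip F j} (subst (i ∈_) (sym eq) (here refl)))
      a = proj₁ (F-left {i} {j} f)
      to-i : to i ≡ inj₁ a
      to-i = proj₂ (F-left {i} {j} f)
      m : M a b
      m = subst (λ i → F i j ≡ true) (trans (sym (from-to i)) (cong from to-i)) f
      only : ∀ {a′} → M a′ b → a ≡ a′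
      only {a′} m′ with subst (from (inj₁ a′) ∈_) eq
                          (∈-elems⁺ {β (suc j)} {flip F j} (proj₁ (Bounded.bounds R-bounded (F⊑R _ _ m′))) m′)
      ... | here i≡ = inj₁-injective (trans (sym to-i) (trans (cong to (sym i≡)) (to-from (inj₁ a′))))

    perfect : PerfectMatching k M
    perfect = record { M⊆E = M⊆E ; exactly = exactly ; unique = unique }

    M-computable : ComputableOn ν M
    M-computable = (λ i j → 𝟙 (F i j)) , to-fun₂ (Compᵇ.value Fᶜ) , λ i j → 𝟙-charValue (sound i j) (complete i j)
      where
      sound : ∀ i j → F i j ≡ true → onV M (to i) (to j)
      sound i j f with to i in eqᵢ | to j in eqⱼ | R-sound {i} {j} (F⊑R _ _ f)
      ... | inj₁ a | inj₂ b | _ rewrite sym eqᵢ | sym eqⱼ | from-to i | from-to j = f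
      complete : ∀ i j → onV M (to i) (to j) → F i j ≡ true
      complete i j m with to i in eqᵢ | to j in eqⱼ
      ... | inj₁ a | inj₂ b rewrite sym eqᵢ | sym eqⱼ | from-to i | from-to j = m

  open Matching R R-bounded wA wB wB≤1 h′ h′0 expanding-A expanding-B using (F; F⊑R; degA; degB; module Algorithm)
  open Algorithm
    (var 0F +ᶜ ∑ᶜ (var 0F) (call nbrBoundᶜ (var 0F ∷ₐ []ₐ)))
    (lit 1 ≤ᶜ χᶜ)
    (Compᵇ.value isAᶜ *ᶜ lit k)
    (Compᵇ.value (notᶜ isAᶜ))
    (lit k *ᶜ from-fun h-computable)
    using (Fᶜ)
  open FromSolution F F⊑R degA degB Fᶜ public

theorem2p9 : (k : ℕ) .{{_ : NonZero k}} (Γ : BipartiteGraph) →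
    let open BipartiteGraph Γ in
    (ν : ℕ ⤖ V) → HighlyComputable ν → ComputablyBipartite ν → CEHHC k →
    ∃[ M ] PerfectMatching k M × ComputableOn ν M
theorem2p9 k Γ ν highly bip cehhc = M , perfect , M-computable
  where open Instance k Γ ν highly bip cehhc
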